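{- Let $a,b,r$ be integers with $1\leq a\leq b<r$ and $a\equiv b \pmod 2$. Let $m\geq 1$ be an integer, and let $m^*\in\{m,m+1\}$ be the unique element of $\{m,m+1\}$ that is odd. Let $G$ be an $m$-edge-connected $r$-regular graph with $n=|V(G)|$ vertices. If one of the following conditions holds, then $G$ has an $(a,b)$-parity factor: (i) $r$ is even, $a$ and $b$ are odd, $n$ is even, $\frac{r}{m}\leq b$ and $a\leq r\left(1-\frac{1}{m}\right)$; (ii) $r$ is odd, $a$ and $b$ are even, and $a\leq r\left(1-\frac{1}{m^*}\right)$; (iii) $r$, $a$ and $b$ are all odd, and $\frac{r}{m^*}\leq b$.
   Context: For integers $1\leq a\leq b$ with $a\equiv b \pmod 2$, an $(a,b)$-parity factor of a graph $G$ is a spanning subgraph $F$ of $G$ such that $a\leq d_F(v)\leq b$ and $d_F(v)\equiv b \pmod 2$ for every vertex $v\in V(G)$, where $d_F(v)$ denotes the degree of $v$ in $F$. -}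

module Defs where

open import Data.Nat using (ℕ; zero; suc; _+_; _*_; _≤_; _<_; _%_)
open import Data.Fin using (Fin)
open import Data.Bool using (Bool; true; false; if_then_else_; _∧_; not; T)
open import Data.List using (List; map; allFin; length)
open import Data.Nat.ListAction using (sum)
open import Data.Bool.ListAction using (any)
open import Data.Product using (_×_; _,_; Σ; proj₁; proj₂)
open import Relation.Binary.PropositionalEquality using (_≡_)
open import Data.Fin using (_≟_)
open import Relation.Nullary.Decidable using (⌊_⌋)

record Graph (n : ℕ) : Set where
  field
    adj     : Fin n → Fin n → Bool
    sym     : ∀ u v → adj u v ≡ adj v u
    loopless : ∀ v → adj v v ≡ false
open Graph public

deg : {n : ℕ} → (Fin n → Fin n → Bool) → Fin n → ℕ
deg {n} A v = sum (map (λ u → if A v u then 1 else 0) (allFin n))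

Regular : {n : ℕ} → Graph n → ℕ → Set
Regular G r = ∀ v → deg (adj G) v ≡ r

data Reach {n : ℕ} (A : Fin n → Fin n → Bool) : Fin n → Fin n → Set where
  here : ∀ {u} → Reach A u u
  step : ∀ {u v w} → T (A u v) → Reach A v w → Reach A u w

Connected : {n : ℕ} → (Fin n → Fin n → Bool) → Set
Connected {n} A = ∀ (u v : Fin n) → Reach A u v

_∈ₑ_ : {n : ℕ} → Fin n × Fin n → List (Fin n × Fin n) → Bool
(u , v) ∈ₑ D = any (λ e → (⌊ proj₁ e ≟ u ⌋ ∧ ⌊ proj₂ e ≟ v ⌋)
                       Data.Bool.∨ (⌊ proj₁ e ≟ v ⌋ ∧ ⌊ proj₂ e ≟ u ⌋)) D

deleteEdges : {n : ℕ} → Graph n → List (Fin n × Fin n) → Fin n → Fin n → Bool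
deleteEdges G D u v = adj G u v ∧ not ((u , v) ∈ₑ D)

EdgeConnected : {n : ℕ} → Graph n → ℕ → Set
EdgeConnected G m = ∀ (D : List _) → length D < m → Connected (deleteEdges G D)

record ParityFactor {n : ℕ} (G : Graph n) (a b : ℕ) : Set where
  field
    F      : Fin n → Fin n → Bool
    F-sym  : ∀ u v → F u v ≡ F v u
    F-sub  : ∀ u v → T (F u v) → T (adj G u v)
    lower  : ∀ v → a ≤ deg F v
    upper  : ∀ v → deg F v ≤ b
    parity : ∀ v → deg F v % 2 ≡ b % 2

{-# OPTIONS --safe #-}

-- Parity factors of G are the traces of perfect matchings of a gadget graph, so Tutte's theorem decides whether
-- one exists. Instead of counting components, give every edge of G the same weight c/Y: it then suffices that
-- the induced weighting of the gadget graph lies in Edmonds' perfect matching polytope. Its odd cut inequalities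
-- reduce to p c + q (Y − c) ≥ Y for each cut of G with p + q edges, q of them flipped, where q + b|X| is odd;
-- since p + q ≥ m and p + q ≡ r|X| (mod 2), this follows from the hypotheses for a suitable c between aY/r and bY/r.
-- Tutte's theorem itself comes from Gallai's lemma applied to a maximal barrier.
module Submission where

open import Defs hiding (sym)
open import Data.Bool using (Bool; true; false; if_then_else_; _∧_; _∨_; not; T; _xor_)
open import Data.Bool.Properties using (T?; T-∧; T-≡; not-involutive; ∧-zeroʳ; xor-comm; xor-identityʳ; xor-same)
  renaming (_≟_ to _≟ᵇ_)
open import Data.Empty using (⊥; ⊥-elim)
open import Data.Fin using (Fin; zero; suc; _≟_; _↑ˡ_; _↑ʳ_; combine; remQuot; splitAt; join)
open import Data.Fin.Properties
  using (all?; any?; remQuot-combine; combine-remQuot; splitAt-↑ˡ; splitAt-↑ʳ; join-splitAt)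
open import Data.List using (List; []; _∷_; length; map; concatMap; allFin; tabulate)
open import Data.List.Membership.Propositional using (lose)
open import Data.List.Membership.Propositional.Properties using (∈-allFin)
open import Data.List.Properties using (length-++; map-tabulate)
open import Data.List.Relation.Unary.Any using (Any; here)
open import Data.List.Relation.Unary.Any.Properties using (any⁺; concatMap⁺)
open import Data.Nat using (ℕ; zero; suc; _+_; _*_; _∸_; _/_; _≤_; _<_; z≤n; s≤s; _%_; _≤?_; >-nonZero)
open import Data.Nat.Divisibility
  using (_∣_; divides; _∣0; ∣m∣n⇒∣m+n; ∣m+n∣m⇒∣n; ∣-refl; ∣n⇒∣m*n; ∣m⇒∣m*n; ∣1⇒≡1; m%n≡0⇒n∣m; n∣m⇒m%n≡0)
open import Data.Nat.DivMod using (m≡m%n+[m/n]*n; /-monoˡ-≤; [m+kn]%n≡m%n)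
import Data.Nat.ListAction as List
open import Data.Nat.Properties hiding (_≟_)
open import Data.Nat.Properties using () renaming (_≟_ to _≟ℕ_)
open import Data.Nat.Tactic.RingSolver using (solve-∀)
open import Data.Product using (_×_; _,_; Σ; ∃; proj₁; proj₂)
open import Data.Sum using (_⊎_; inj₁; inj₂; map₁; map₂)
open import Data.Unit using (tt)
import Data.Vec.Functional as Vector
open import Function using (_∘_; id; case_of_; module Equivalence)
open import Relation.Binary.PropositionalEquality
  using (_≡_; _≢_; _≗_; refl; sym; trans; cong; cong₂; subst; subst₂; module ≡-Reasoning)
open import Relation.Nullary using (¬_; Dec; yes; no; contradiction; ¬?; _×-dec_; _→-dec_)
open import Relation.Nullary.Decidable using (⌊_⌋; toWitness; fromWitness; map′; decidable-stable)

open import Algebra.Properties.Semiring.Sum +-*-semiring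
  using (sum; sum-syntax; sum-cong-≗; ∑-distrib-+; ∑-comm; *-distribˡ-sum; *-distribʳ-sum)

-- The quantity `p c + q (Y − c)` is at least `Y` as soon as `p` and `q` are both positive, so only
-- cuts whose edges are all flipped or all unflipped constrain `c`. If `b` is even, `q` is odd: only
-- the all-flipped cuts matter and `c` should be least. If `r` and `b` are odd, `p` is odd: only the
-- unflipped cuts matter and `c` should be greatest. In both cases parity raises the number of cut
-- edges from `m` to `m*`. If `r` is even and `b` odd, neither kind is excluded, and it is enough
-- that `c/Y` lies between `1/m` and `1 − 1/m`. The range of `c` is what the loops of the gadget can
-- absorb: each vertex has `(b − a)/2` loops of weight `z/Y`, and a total weight of `b` at the
-- vertex means `r c + (b − a) z = b Y` with `0 ≤ z ≤ Y`. The common denominator `Y` keeps all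
-- weights in `ℕ`.

private variable
  n : ℕ

-- Finite sums, counting and parity

𝟙 : Bool → ℕ
𝟙 b = if b then 1 else 0

count : (Fin n → Bool) → ℕ
count P = ∑[ i < _ ] 𝟙 (P i)

𝟙≤1 : ∀ b → 𝟙 b ≤ 1
𝟙≤1 true  = ≤-refl
𝟙≤1 false = z≤n

T⇒1≤𝟙 : ∀ {b} → T b → 1 ≤ 𝟙 b
T⇒1≤𝟙 {true} _ = ≤-refl

sum-mono : {f g : Fin n → ℕ} → (∀ i → f i ≤ g i) → sum f ≤ sum g
sum-mono {n = zero}  f≤g = z≤n
sum-mono {n = suc _} f≤g = +-mono-≤ (f≤g zero) (sum-mono (f≤g ∘ suc))

term≤sum : (f : Fin n → ℕ) → ∀ i → f i ≤ sum f
term≤sum f zero    = m≤m+n _ _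
term≤sum f (suc i) = ≤-trans (term≤sum (f ∘ suc) i) (m≤n+m _ _)

sum-const : ∀ n c → ∑[ i < n ] c ≡ n * c
sum-const zero    c = refl
sum-const (suc n) c = cong (c +_) (sum-const n c)

sum-zero : {f : Fin n → ℕ} → (∀ i → f i ≡ 0) → sum f ≡ 0
sum-zero {n} f≡0 = trans (sum-cong-≗ f≡0) (trans (sum-const n 0) (*-zeroʳ n))

sum-even : {f : Fin n → ℕ} → (∀ i → 2 ∣ f i) → 2 ∣ sum f
sum-even {n = zero}  2∣f = 2 ∣0
sum-even {n = suc _} 2∣f = ∣m∣n⇒∣m+n (2∣f zero) (sum-even (2∣f ∘ suc))

sum-δ : (g : Fin n → ℕ) → ∀ a → ∑[ y < n ] (𝟙 ⌊ a ≟ y ⌋ * g y) ≡ g a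
sum-δ {suc n} g zero = trans (cong₂ _+_ (*-identityˡ (g zero)) (sum-zero {n} λ _ → refl)) (+-identityʳ _)
sum-δ g (suc a) = trans (sum-cong-≗ λ y → cong (λ b → 𝟙 b * g (suc y)) (suc-≟ y)) (sum-δ (g ∘ suc) a)
  where
  suc-≟ : ∀ y → ⌊ suc a ≟ suc y ⌋ ≡ ⌊ a ≟ y ⌋
  suc-≟ y with a ≟ y
  ... | yes _ = refl
  ... | no  _ = refl

count-single : ∀ (a : Fin n) → count (λ y → ⌊ a ≟ y ⌋) ≡ 1
count-single a = trans (sum-cong-≗ λ y → sym (*-identityʳ (𝟙 ⌊ a ≟ y ⌋))) (sum-δ (λ _ → 1) a)

sum-allFin : (f : Fin n → ℕ) → List.sum (map f (allFin n)) ≡ sum f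
sum-allFin f = trans (cong List.sum (map-tabulate id f)) (sum-tabulate f)
  where
  sum-tabulate : ∀ {n} (f : Fin n → ℕ) → List.sum (tabulate f) ≡ sum f
  sum-tabulate {zero}  f = refl
  sum-tabulate {suc n} f = cong (f zero +_) (sum-tabulate (f ∘ suc))

2∣m+m : ∀ m → 2 ∣ m + m
2∣m+m m = divides m (trans (cong (m +_) (sym (+-identityʳ m))) (*-comm 2 m))

odd+odd : ∀ {m o} → ¬ 2 ∣ m → ¬ 2 ∣ o → 2 ∣ m + o
odd+odd {zero}        ¬m ¬o = contradiction (2 ∣0) ¬m
odd+odd {suc zero}    {zero} ¬m ¬o = contradiction (2 ∣0) ¬o
odd+odd {suc zero}    {suc zero} ¬m ¬o = ∣-refl
odd+odd {suc zero}    {suc (suc o)} ¬m ¬o =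
  ∣m∣n⇒∣m+n (∣-refl {2}) (odd+odd {1} ¬m (¬o ∘ ∣m∣n⇒∣m+n ∣-refl))
odd+odd {suc (suc m)} ¬m ¬o = ∣m∣n⇒∣m+n ∣-refl (odd+odd {m} (¬m ∘ ∣m∣n⇒∣m+n ∣-refl) ¬o)

-- Once index `zero` is split off, its row and its column have equal sums and together contribute an
-- even number.
handshake : ∀ n (m : Fin n → Fin n → ℕ) → (∀ i j → m i j ≡ m j i) → (∀ i → m i i ≡ 0) →
            2 ∣ ∑[ i < n ] ∑[ j < n ] m i j
handshake zero    m sy di = 2 ∣0
handshake (suc n) m sy di = subst (2 ∣_) (sym split)
  (∣m∣n⇒∣m+n (2∣m+m (∑[ j < n ] m zero (suc j)))
             (handshake n (λ i j → m (suc i) (suc j)) (λ i j → sy (suc i) (suc j)) (di ∘ suc)))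
  where
  row   = ∑[ j < n ] m zero (suc j)
  inner = ∑[ i < n ] ∑[ j < n ] m (suc i) (suc j)
  split : ∑[ i < suc n ] ∑[ j < suc n ] m i j ≡ row + row + inner
  split = trans (cong₂ _+_ (cong (_+ row) (di zero))
                   (trans (∑-distrib-+ (λ i → m (suc i) zero) _)
                          (cong (_+ inner) (sum-cong-≗ λ i → sy (suc i) zero))))
                (sym (+-assoc row row inner))

Involutive : (Fin n → Fin n) → Set
Involutive f = ∀ x → f (f x) ≡ x

moves : (Fin n → Fin n) → Fin n → Bool
moves f x = not ⌊ f x ≟ x ⌋

⌊⌋-⇔ : ∀ {P Q : Set} (P? : Dec P) (Q? : Dec Q) → (P → Q) → (Q → P) → ⌊ P? ⌋ ≡ ⌊ Q? ⌋
⌊⌋-⇔ (yes p) (yes q) to from = refl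
⌊⌋-⇔ (no ¬p) (no ¬q) to from = refl
⌊⌋-⇔ (yes p) (no ¬q) to from = contradiction (to p) ¬q
⌊⌋-⇔ (no ¬p) (yes q) to from = contradiction (from q) ¬p

-- The moved points of `C` are paired as `x` and `f x`; these pairs are the edges of a graph whose
-- degree sum is the count.
moved-even : (f : Fin n → Fin n) → Involutive f → (C : Fin n → Bool) → (∀ x → C (f x) ≡ C x) →
             2 ∣ count (λ x → C x ∧ moves f x)
moved-even {n} f inv C C-f = subst (2 ∣_) (sum-cong-≗ row) (handshake n m m-sym m-diag)
  where
  w : Fin n → ℕ
  w x = 𝟙 (C x ∧ moves f x)
  m : Fin n → Fin n → ℕ
  m x y = 𝟙 ⌊ f x ≟ y ⌋ * w y
  row : ∀ x → ∑[ y < n ] m x y ≡ w x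
  row x = trans (sum-δ w (f x)) (cong₂ (λ b c → 𝟙 (b ∧ not c)) (C-f x)
    (⌊⌋-⇔ (f (f x) ≟ f x) (f x ≟ x) (λ e → trans (sym e) (inv x)) (cong f)))
  m-sym : ∀ x y → m x y ≡ m y x
  m-sym x y with f x ≟ y | f y ≟ x
  ... | yes refl | yes _ = cong (_+ 0) (trans (sym (sum-δ w (f x))) (row x))
  ... | no _     | no _  = refl
  ... | yes refl | no ¬e = contradiction (inv x) ¬e
  ... | no ¬e    | yes refl = contradiction (inv y) ¬e
  m-diag : ∀ x → m x x ≡ 0
  m-diag x with f x ≟ x
  ... | yes _ = trans (+-identityʳ _) (cong 𝟙 (∧-zeroʳ (C x)))
  ... | no _ = refl

-- Matchings and Tutte's theorem

-- Functions are searched value by value, with `resp` in place of function extensionality. This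
-- makes it decidable whether some maximum matching misses given vertices.
∃-function? : ∀ m {k} (P : (Fin m → Fin k) → Set) → (∀ {f g} → f ≗ g → P f → P g) →
              (∀ f → Dec (P f)) → Dec (∃ P)
∃-function? zero    P resp P? =
  map′ (nil ,_) (λ (_ , p) → resp (λ ()) p) (P? nil)
  where
  nil : Fin 0 → _
  nil ()
∃-function? (suc m) P resp P? = map′
  (λ (x , f , p) → (x Vector.∷ f) , p)
  (λ (f , p) → f zero , f ∘ suc , resp (λ { zero → refl ; (suc _) → refl }) p)
  (any? λ x → ∃-function? m (λ f → P (x Vector.∷ f))
    (λ f≗g → resp λ { zero → refl ; (suc i) → f≗g i }) (λ f → P? (x Vector.∷ f)))

-- A matching is an involution whose fixed points are the unmatched vertices. `joined` adds an edge
-- to it, `isolated` below removes one.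
joined : ∀ {n} → Fin n → Fin n → (Fin n → Fin n) → Fin n → Fin n
joined x y f z with z ≟ x | z ≟ y
... | yes _ | _     = y
... | no _  | yes _ = x
... | no _  | no _  = f z

joined-fst : ∀ {n} (x y : Fin n) f → joined x y f x ≡ y
joined-fst x y f with x ≟ x
... | yes _ = refl
... | no x≢x = contradiction refl x≢x

joined-snd : ∀ {n} {x y : Fin n} f → x ≢ y → joined x y f y ≡ x
joined-snd {x = x} {y} f x≢y with y ≟ x | y ≟ y
... | yes y≡x | _ = contradiction (sym y≡x) x≢y
... | no _ | yes _ = refl
... | no _ | no y≢y = contradiction refl y≢y

joined-other : ∀ {n} {x y z : Fin n} f → z ≢ x → z ≢ y → joined x y f z ≡ f z
joined-other {x = x} {y} {z} f z≢x z≢y with z ≟ x | z ≟ y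
... | yes z≡x | _ = contradiction z≡x z≢x
... | no _ | yes z≡y = contradiction z≡y z≢y
... | no _ | no _ = refl

isolated : ∀ {n} → Fin n → (Fin n → Fin n) → Fin n → Fin n
isolated x f z with z ≟ x | z ≟ f x
... | yes _ | _     = z
... | no _  | yes _ = z
... | no _  | no _  = f z

isolated-fst : ∀ {n} (x : Fin n) f → isolated x f x ≡ x
isolated-fst x f with x ≟ x
... | yes _ = refl
... | no x≢x = contradiction refl x≢x

isolated-snd : ∀ {n} (x : Fin n) f → isolated x f (f x) ≡ f x
isolated-snd x f with f x ≟ x | f x ≟ f x
... | yes _ | _ = refl
... | no _ | yes _ = refl
... | no _ | no ¬e = contradiction refl ¬e

isolated-other : ∀ {n} {x z : Fin n} f → z ≢ x → z ≢ f x → isolated x f z ≡ f z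
isolated-other {x = x} {z} f z≢x z≢y with z ≟ x | z ≟ f x
... | yes z≡x | _ = contradiction z≡x z≢x
... | no _ | yes z≡y = contradiction z≡y z≢y
... | no _ | no _ = refl

moves-yes : ∀ {n} (f : Fin n → Fin n) {x} → f x ≢ x → moves f x ≡ true
moves-yes f {x} fx≢x with f x ≟ x
... | yes e = contradiction e fx≢x
... | no _ = refl

moves-no : ∀ {n} (f : Fin n → Fin n) {x} → f x ≡ x → moves f x ≡ false
moves-no f {x} fx≡x with f x ≟ x
... | yes _ = refl
... | no ¬e = contradiction fx≡x ¬e

-- Twice the number of matching edges, so sizes change in steps of 2.
covered : ∀ {n} → (Fin n → Fin n) → ℕ
covered f = count (moves f)

covered-+2 : ∀ {n} (f g : Fin n → Fin n) {x y : Fin n} → x ≢ y →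
             f x ≢ x → f y ≢ y → g x ≡ x → g y ≡ y → (∀ z → z ≢ x → z ≢ y → f z ≡ g z) →
             covered f ≡ 2 + covered g
covered-+2 {n} f g {x} {y} x≢y fx fy gx gy agree = begin
  ∑[ z < n ] 𝟙 (moves f z)                                              ≡⟨ sum-cong-≗ pointwise ⟩
  ∑[ z < n ] (𝟙 ⌊ x ≟ z ⌋ + (𝟙 ⌊ y ≟ z ⌋ + 𝟙 (moves g z)))            ≡⟨ ∑-distrib-+ (λ z → 𝟙 ⌊ x ≟ z ⌋) _ ⟩
  count (λ z → ⌊ x ≟ z ⌋) + ∑[ z < n ] (𝟙 ⌊ y ≟ z ⌋ + 𝟙 (moves g z))  ≡⟨ cong₂ _+_ (count-single x) (∑-distrib-+ (λ z → 𝟙 ⌊ y ≟ z ⌋) _) ⟩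
  1 + (count (λ z → ⌊ y ≟ z ⌋) + covered g)                            ≡⟨ cong (λ c → 1 + (c + covered g)) (count-single y) ⟩
  2 + covered g                                                         ∎
  where
  open ≡-Reasoning
  pointwise : ∀ z → 𝟙 (moves f z) ≡ 𝟙 ⌊ x ≟ z ⌋ + (𝟙 ⌊ y ≟ z ⌋ + 𝟙 (moves g z))
  pointwise z with x ≟ z | y ≟ z
  ... | yes refl | yes refl = contradiction refl x≢y
  ... | yes refl | no _ = trans (cong 𝟙 (moves-yes f fx)) (cong (suc ∘ 𝟙) (sym (moves-no g gx)))
  ... | no _ | yes refl = trans (cong 𝟙 (moves-yes f fy)) (cong (suc ∘ 𝟙) (sym (moves-no g gy)))
  ... | no x≢z | no y≢z = cong 𝟙 (cong (λ w → not ⌊ w ≟ z ⌋) (agree z (x≢z ∘ sym) (y≢z ∘ sym)))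

module Matchings {N : ℕ} (E : Fin N → Fin N → Set) (E-sym : ∀ {x y} → E x y → E y x)
                 (E? : ∀ x y → Dec (E x y)) where

  -- Deleting the vertices in `A` is expressed by keeping them fixed, so that all induced subgraphs
  -- share the vertex type `Fin N`.
  record Matching (A : Fin N → Set) (f : Fin N → Fin N) : Set where
    field
      involutive : Involutive f
      edge       : ∀ x → f x ≢ x → E x (f x)
      avoids     : ∀ x → A x → f x ≡ x

    injective : ∀ {x y} → f x ≡ f y → x ≡ y
    injective {x} {y} e = trans (sym (involutive x)) (trans (cong f e) (involutive y))
  open Matching

  private variable
    A A′ : Fin N → Set
    f M M′ : Fin N → Fin N
    k : ℕ
    t u v x y : Fin N

  restrict : (∀ x → A x → A′ x) → Matching A′ f → Matching A f
  restrict A⊆A′ m = record { involutive = involutive m ; edge = edge m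
                           ; avoids = λ x → avoids m x ∘ A⊆A′ x }

  connect : Matching A f → x ≢ y → E x y → ¬ A x → ¬ A y → f x ≡ x → f y ≡ y →
         Matching A (joined x y f)
  connect {A = A} {f = f} {x = x} {y = y} m x≢y exy ¬Ax ¬Ay fx fy = record
    { involutive = inv ; edge = ed ; avoids = av }
    where
    g = joined x y f
    inv : Involutive g
    inv z with z ≟ x | z ≟ y
    ... | yes refl | _ = joined-snd f x≢y
    ... | no _ | yes refl = joined-fst x y f
    ... | no z≢x | no z≢y = trans
      (joined-other f (λ e → z≢x (injective m (trans e (sym fx))))
                      (λ e → z≢y (injective m (trans e (sym fy)))))
      (involutive m z)
    ed : ∀ z → g z ≢ z → E z (g z)
    ed z gz≢z with z ≟ x | z ≟ y
    ... | yes refl | _ = exy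
    ... | no _ | yes refl = E-sym exy
    ... | no z≢x | no z≢y = edge m z gz≢z
    av : ∀ z → A z → g z ≡ z
    av z Az = trans (joined-other f (λ { refl → ¬Ax Az }) (λ { refl → ¬Ay Az })) (avoids m z Az)

  join-covered : ∀ (f : Fin N → Fin N) → x ≢ y → f x ≡ x → f y ≡ y →
                 covered (joined x y f) ≡ 2 + covered f
  join-covered {x = x} {y = y} f x≢y fx fy = covered-+2 (joined x y f) f x≢y
    (λ e → x≢y (trans (sym e) (joined-fst x y f)))
    (λ e → x≢y (trans (sym (joined-snd f x≢y)) e))
    fx fy (λ z → joined-other f)

  isolate : Matching A f → ∀ x → Matching (λ z → A z ⊎ z ≡ x ⊎ z ≡ f x) (isolated x f)
  isolate {A = A} {f = f} m x = record { involutive = inv ; edge = ed ; avoids = av }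
    where
    g = isolated x f
    inv : Involutive g
    inv z with z ≟ x | z ≟ f x
    ... | yes refl | _ = isolated-fst x f
    ... | no _ | yes refl = isolated-snd x f
    ... | no z≢x | no z≢fx = trans
      (isolated-other f (λ e → z≢fx (trans (sym (involutive m z)) (cong f e)))
                        (λ e → z≢x (injective m e)))
      (involutive m z)
    ed : ∀ z → g z ≢ z → E z (g z)
    ed z gz≢z with z ≟ x | z ≟ f x
    ... | yes _ | _ = contradiction refl gz≢z
    ... | no _ | yes _ = contradiction refl gz≢z
    ... | no _ | no _ = edge m z gz≢z
    av : ∀ z → A z ⊎ z ≡ x ⊎ z ≡ f x → g z ≡ z
    av z p with z ≟ x | z ≟ f x
    ... | yes _ | _ = refl
    ... | no _ | yes _ = refl
    av z (inj₁ Az) | no _ | no _ = avoids m z Az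
    av z (inj₂ (inj₁ z≡x)) | no z≢x | no _ = contradiction z≡x z≢x
    av z (inj₂ (inj₂ z≡fx)) | no _ | no z≢fx = contradiction z≡fx z≢fx

  isolate-covered : Matching A f → ∀ {x} → f x ≢ x → covered f ≡ 2 + covered (isolated x f)
  isolate-covered {f = f} m {x} fx≢x = covered-+2 f (isolated x f) (fx≢x ∘ sym) fx≢x
    (λ e → fx≢x (injective m e)) (isolated-fst x f) (isolated-snd x f)
    (λ z z≢x z≢fx → sym (isolated-other f z≢x z≢fx))

  covered-even : Matching A f → 2 ∣ covered f
  covered-even {f = f} m = moved-even f (involutive m) (λ _ → true) (λ _ → refl)

  Bounds : ℕ → (Fin N → Set) → Set
  Bounds k A = ∀ {R} → Matching A R → covered R ≤ k

  record Missing (A : Fin N → Set) (k : ℕ) (u v : Fin N) : Set where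
    constructor missing
    field
      {R}      : Fin N → Fin N
      matching : Matching A R
      large    : k ≤ covered R
      missesˡ  : R u ≡ u
      missesʳ  : R v ≡ v

  -- Gallai's lemma in the form: not being missed simultaneously by a maximum matching is a transitive relation.
  -- The alternating path from t is followed two edges t–s–w at a time: in the graph without t and s both
  -- matchings stay maximum, M′ now misses w, and the edge s–w is put back into the matching found there.
  gallai : ∀ k {A} → Bounds k A → Matching A M → k ≤ covered M → Matching A M′ → k ≤ covered M′ →
           M u ≡ u → M v ≡ v → u ≢ v → M′ t ≡ t →
           Missing A k t u ⊎ Missing A k t v
  gallai {M} {M′} {u} {v} {t} k {A} bound m k≤M m′ k≤M′ Mu Mv u≢v M′t with M t ≟ t
  ... | yes Mt = inj₁ (missing m k≤M Mt Mu)
  ... | no Mt≢t with M′ (M t) ≟ M t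
  -- Here `M′` misses both ends of the edge `t`-`M t`, and adding that edge would exceed the
  -- maximum.
  ...   | yes M′s = contradiction (bound (connect m′ (Mt≢t ∘ sym) (edge m t Mt≢t) ¬At ¬As M′t M′s))
                      (<⇒≱ (begin-strict
                        k                              ≤⟨ k≤M′ ⟩
                        covered M′                     <⟨ m<n+m _ {2} (s≤s z≤n) ⟩
                        2 + covered M′                 ≡⟨ join-covered M′ (Mt≢t ∘ sym) M′t M′s ⟨
                        covered (joined t (M t) M′)    ∎))
    where
    open ≤-Reasoning
    ¬At = Mt≢t ∘ avoids m t
    ¬As = λ As → Mt≢t (injective m (avoids m (M t) As))
  ...   | no M′s≢s = go k bound k≤M k≤M′
    where
    s = M t
    w = M′ s
    ¬At = Mt≢t ∘ avoids m t
    ¬As = M′s≢s ∘ avoids m′ s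
    ¬Aw = λ Aw → M′s≢s (injective m′ (avoids m′ w Aw))
    s≢w = M′s≢s ∘ sym
    t≢w : t ≢ w
    t≢w t≡w = Mt≢t (trans (sym (involutive m′ s)) (trans (cong M′ (sym t≡w)) M′t))
    misses⇒≢s : ∀ {z} → M z ≡ z → z ≢ s
    misses⇒≢s Mz refl = Mt≢t (injective m Mz)
    B : Fin N → Set
    B z = A z ⊎ z ≡ t ⊎ z ≡ s
    extend : ∀ {R j z} → Matching B R → j ≤ covered R → R w ≡ w → R z ≡ z → z ≢ s → z ≢ w →
             Missing A (2 + j) t z
    extend {R} {j} r j≤R Rw Rz z≢s z≢w = missing
      (connect (restrict (λ _ → inj₁) r) s≢w (edge m′ s M′s≢s) ¬As ¬Aw Rs Rw)
      (subst (2 + j ≤_) (sym (join-covered R s≢w Rs Rw)) (+-monoʳ-≤ 2 j≤R))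
      (trans (joined-other R (Mt≢t ∘ sym) t≢w) (avoids r t (inj₂ (inj₁ refl))))
      (trans (joined-other R z≢s z≢w) Rz)
      where Rs = avoids r s (inj₂ (inj₂ refl))
    m° : Matching B (isolated t M)
    m° = isolate m t
    misses° : ∀ {z} → M z ≡ z → isolated t M z ≡ z
    misses° {z} Mz with z ≟ t | z ≟ s
    ... | yes _ | _ = refl
    ... | no _ | yes _ = refl
    ... | no _ | no _ = Mz
    -- Removing `s`-`w` suffices, because `M′` misses `t` already.
    m′° : Matching B (isolated s M′)
    m′° = record
      { involutive = involutive iso
      ; edge       = edge iso
      ; avoids     = λ { z (inj₁ Az) → avoids iso z (inj₁ Az)
                       ; z (inj₂ (inj₁ refl)) → trans (isolated-other M′ (Mt≢t ∘ sym) t≢w) M′t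
                       ; z (inj₂ (inj₂ refl)) → isolated-fst s M′ } }
      where iso = isolate m′ s
    -- Matching on `k` makes the recursion structural; 0 and 1 are impossible because `M` covers
    -- both `t` and `s`.
    go : ∀ k → Bounds k A → k ≤ covered M → k ≤ covered M′ → Missing A k t u ⊎ Missing A k t v
    go zero bound _ _ = contradiction (bound m)
      (λ M≤0 → case subst (_≤ 0) (isolate-covered m Mt≢t) M≤0 of λ ())
    go (suc zero) bound _ _ = contradiction (bound m)
      (λ M≤1 → case subst (_≤ 1) (isolate-covered m Mt≢t) M≤1 of λ { (s≤s ()) })
    go (suc (suc j)) bound k≤M k≤M′ with w ≟ u | w ≟ v
    -- The alternating path has reached `u`: exchanging `t`-`s` for `s`-`u` in `M` gives a matching
    -- that misses `t` and still misses `v`.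
    ... | yes w≡u | _ = inj₂ (extend m° j≤M° (misses° (subst (λ z → M z ≡ z) (sym w≡u) Mu))
                          (misses° Mv) (misses⇒≢s Mv) (λ v≡w → u≢v (trans (sym w≡u) (sym v≡w))))
      where j≤M° = +-cancelˡ-≤ 2 j _ (subst (2 + j ≤_) (isolate-covered m Mt≢t) k≤M)
    ... | no _ | yes w≡v = inj₁ (extend m° j≤M° (misses° (subst (λ z → M z ≡ z) (sym w≡v) Mv))
                          (misses° Mu) (misses⇒≢s Mu) (λ u≡w → u≢v (trans u≡w w≡v)))
      where j≤M° = +-cancelˡ-≤ 2 j _ (subst (2 + j ≤_) (isolate-covered m Mt≢t) k≤M)
    ... | no w≢u | no w≢v with gallai j bound° m° j≤M° m′° j≤M′° (misses° Mu) (misses° Mv) u≢v (isolated-snd s M′)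
      where
      j≤M° = +-cancelˡ-≤ 2 j _ (subst (2 + j ≤_) (isolate-covered m Mt≢t) k≤M)
      j≤M′° = +-cancelˡ-≤ 2 j _ (subst (2 + j ≤_) (isolate-covered m′ M′s≢s) k≤M′)
      -- A larger matching that avoids `t` and `s` could be enlarged by the edge `t`-`s`.
      bound° : Bounds j B
      bound° {R} r = +-cancelˡ-≤ 2 _ j (subst (_≤ 2 + j) (join-covered R (Mt≢t ∘ sym) Rt Rs)
        (bound (connect (restrict (λ _ → inj₁) r) (Mt≢t ∘ sym) (edge m t Mt≢t) ¬At ¬As Rt Rs)))
        where
        Rt = avoids r t (inj₂ (inj₁ refl))
        Rs = avoids r s (inj₂ (inj₂ refl))
    ...   | inj₁ (missing r j≤R Rw Ru) = inj₁ (extend r j≤R Rw Ru (misses⇒≢s Mu) (w≢u ∘ sym))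
    ...   | inj₂ (missing r j≤R Rw Rv) = inj₂ (extend r j≤R Rw Rv (misses⇒≢s Mv) (w≢v ∘ sym))

  Matching? : (∀ x → Dec (A x)) → ∀ f → Dec (Matching A f)
  Matching? A? f = map′
    (λ (i , e , a) → record { involutive = i ; edge = e ; avoids = a })
    (λ m → involutive m , edge m , avoids m)
    ((all? λ x → f (f x) ≟ x) ×-dec (all? λ x → ¬? (f x ≟ x) →-dec E? x (f x))
      ×-dec (all? λ x → A? x →-dec f x ≟ x))

  Matching-resp : f ≗ M → Matching A f → Matching A M
  Matching-resp {f} {M} f≗M m = record
    { involutive = λ x → trans (sym (trans (f≗M (f x)) (cong M (f≗M x)))) (involutive m x)
    ; edge = λ x Mx≢x → subst (E x) (f≗M x) (edge m x (λ fx → Mx≢x (trans (sym (f≗M x)) fx)))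
    ; avoids = λ x Ax → trans (sym (f≗M x)) (avoids m x Ax) }

  covered-resp : f ≗ M → covered f ≡ covered M
  covered-resp f≗M = sum-cong-≗ λ x → cong (λ y → 𝟙 (not ⌊ y ≟ x ⌋)) (f≗M x)

  Missing? : (∀ x → Dec (A x)) → ∀ k u v → Dec (Missing A k u v)
  Missing? {A} A? k u v = map′
    (λ (R , m , l , Ru , Rv) → missing m l Ru Rv)
    (λ (missing {R} m l Ru Rv) → R , m , l , Ru , Rv)
    (∃-function? N (λ R → Matching A R × k ≤ covered R × R u ≡ u × R v ≡ v)
      (λ f≗g (m , l , fu , fv) → Matching-resp f≗g m , subst (k ≤_) (covered-resp f≗g) l
        , trans (sym (f≗g u)) fu , trans (sym (f≗g v)) fv)
      (λ R → Matching? A? R ×-dec k ≤? covered R ×-dec R u ≟ u ×-dec R v ≟ v))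

  -- Tutte's obstruction without a notion of component: for representatives `s` in `B`, the sets
  -- `C s` are disjoint odd unions of components of the graph without `S`.
  record Barrier : Set where
    field
      S       : Fin N → Bool
      B       : Fin N → Bool
      C       : Fin N → Fin N → Bool
      C-odd   : ∀ s → T (B s) → ¬ 2 ∣ count (C s)
      C∩S     : ∀ {s x} → T (C s x) → ¬ T (S x)
      C∩C     : ∀ {r s x} → T (B r) → T (B s) → T (C r x) → T (C s x) → r ≡ s
      closed  : ∀ {s x y} → E x y → ¬ T (S x) → ¬ T (S y) → T (C s x) → T (C s y)
      surplus : count S < count B

  count-fixed : ∀ {P Q R : Set} (P? : Dec P) (Q? : Dec Q) (R? : Dec R) → (P → Q → R) → (R → P × Q) →
                𝟙 ⌊ P? ⌋ ≡ 𝟙 (⌊ P? ⌋ ∧ not ⌊ Q? ⌋) + 𝟙 ⌊ R? ⌋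
  count-fixed (yes p) (yes q) (yes r) to from = refl
  count-fixed (yes p) (yes q) (no ¬r) to from = contradiction (to p q) ¬r
  count-fixed (yes p) (no ¬q) (yes r) to from = contradiction (proj₂ (from r)) ¬q
  count-fixed (yes p) (no ¬q) (no ¬r) to from = refl
  count-fixed (no ¬p) _       (yes r) to from = contradiction (proj₁ (from r)) ¬p
  count-fixed (no ¬p) _       (no ¬r) to from = refl

  missing-sym : Missing A k u v → Missing A k v u
  missing-sym (missing m l Ru Rv) = missing m l Rv Ru

  -- When every vertex outside A is missed by some maximum matching, "not missed simultaneously" is an
  -- equivalence relation there, and its classes play the role of the odd components.
  module _ (k : ℕ) (A : Fin N → Bool) (bound : Bounds k (T ∘ A)) {M : Fin N → Fin N}
           (m : Matching (T ∘ A) M) (k≤M : k ≤ covered M) (room : k + (count A + count A) < N)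
           (missable : ∀ x → ¬ T (A x) → Missing (T ∘ A) k x x) where

    private
      Miss : Fin N → Fin N → Set
      Miss = Missing (T ∘ A) k

      Miss? : ∀ x y → Dec (Miss x y)
      Miss? = Missing? (λ x → T? (A x)) k

      _∼_ : Fin N → Fin N → Set
      x ∼ y = x ≢ y → ¬ Miss x y

      ∼-sym : x ∼ y → y ∼ x
      ∼-sym x∼y y≢x = x∼y (y≢x ∘ sym) ∘ missing-sym

      -- Some maximum matching misses `y`. If another one missed `x` and `t` together, Gallai's
      -- lemma would give one that misses `y` along with `x` or with `t`.
      ∼-trans : ¬ T (A y) → x ∼ y → y ∼ t → x ∼ t
      ∼-trans {y} {x} {t} ¬Ay x∼y y∼t x≢t (missing r k≤R Rx Rt) with x ≟ y | y ≟ t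
      ... | yes refl | _ = y∼t x≢t (missing r k≤R Rx Rt)
      ... | no _ | yes refl = x∼y x≢t (missing r k≤R Rx Rt)
      ... | no x≢y | no y≢t with missable y ¬Ay
      ...   | missing r′ k≤R′ R′y _ with gallai k bound r k≤R r′ k≤R′ Rx Rt x≢t R′y
      ...     | inj₁ miss = x∼y x≢y (missing-sym miss)
      ...     | inj₂ miss = y∼t y≢t miss

      edge⇒∼ : E x y → ¬ T (A x) → ¬ T (A y) → x ∼ y
      edge⇒∼ {x} {y} exy ¬Ax ¬Ay x≢y (missing {R} r k≤R Rx Ry) =
        <⇒≱ (s≤s (≤-trans k≤R (n≤1+n _)))
            (subst (_≤ k) (join-covered R x≢y Rx Ry) (bound (connect r x≢y exy ¬Ax ¬Ay Rx Ry)))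

      B : Fin N → Bool
      B s = ⌊ M s ≟ s ×-dec ¬? (T? (A s)) ⌋

      ∼? : ∀ s x → Dec (s ∼ x)
      ∼? s x = ¬? (s ≟ x) →-dec ¬? (Miss? s x)

      C? : ∀ s x → Dec (¬ T (A x) × s ∼ x)
      C? s x = ¬? (T? (A x)) ×-dec ∼? s x

      C : Fin N → Fin N → Bool
      C s x = ⌊ C? s x ⌋

      fixed⇒≡ : ∀ {s x} → M s ≡ s → M x ≡ x → s ∼ x → s ≡ x
      fixed⇒≡ {s} {x} Ms Mx s∼x = decidable-stable (s ≟ x) (λ s≢x → s∼x s≢x (missing m k≤M Ms Mx))

      B-fixed : ∀ {s} → T (B s) → M s ≡ s × ¬ T (A s)
      B-fixed = toWitness

      -- `M` maps the class of `s` to itself, because matched vertices are equivalent, and fixes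
      -- only `s` in it, because two vertices missed by the maximum matching `M` are not equivalent.
      C-odd : ∀ s → T (B s) → ¬ 2 ∣ count (C s)
      C-odd s Bs 2∣C = case ∣1⇒≡1 (∣m+n∣m⇒∣n (subst (2 ∣_) split 2∣C)
                         (moved-even M (involutive m) (C s) C-M)) of λ ()
        where
        Ms  = proj₁ (B-fixed Bs)
        ¬As = proj₂ (B-fixed Bs)
        C-step : ∀ x → ¬ T (A x) × s ∼ x → ¬ T (A (M x)) × s ∼ M x
        C-step x (¬Ax , s∼x) with M x ≟ x
        ... | yes e = subst (λ y → ¬ T (A y) × s ∼ y) (sym e) (¬Ax , s∼x)
        ... | no Mx≢x = ¬AMx , ∼-trans ¬Ax s∼x (edge⇒∼ (edge m x Mx≢x) ¬Ax ¬AMx)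
          where ¬AMx = λ a → Mx≢x (injective m (avoids m (M x) a))
        C-M : ∀ x → C s (M x) ≡ C s x
        C-M x = ⌊⌋-⇔ (C? s (M x)) (C? s x)
          (subst (λ y → ¬ T (A y) × s ∼ y) (involutive m x) ∘ C-step (M x)) (C-step x)
        pointwise : ∀ x → 𝟙 (C s x) ≡ 𝟙 (C s x ∧ moves M x) + 𝟙 ⌊ s ≟ x ⌋
        pointwise x = count-fixed (C? s x) (M x ≟ x) (s ≟ x)
          (λ (_ , s∼x) Mx → fixed⇒≡ Ms Mx s∼x)
          (λ { refl → (¬As , λ s≢s → contradiction refl s≢s) , Ms })
        split : count (C s) ≡ count (λ x → C s x ∧ moves M x) + 1
        split = trans (sum-cong-≗ pointwise)
                  (trans (∑-distrib-+ (λ x → 𝟙 (C s x ∧ moves M x)) _)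
                         (cong (count (λ x → C s x ∧ moves M x) +_) (count-single s)))

      -- Every vertex is covered by `M`, in `A` or in `B`. Hence `B` has at least `N − k − count A`
      -- elements, and `room` makes this exceed `count A`.
      surplus : count A < count B
      surplus = +-cancelˡ-< (count A) _ _ (+-cancelˡ-< k _ _ (begin-strict
        k + (count A + count A)                                      <⟨ room ⟩
        N                                                            ≡⟨ *-identityʳ N ⟨
        N * 1                                                        ≡⟨ sum-const N 1 ⟨
        ∑[ x < N ] 1                                                 ≤⟨ sum-mono pointwise ⟩
        ∑[ x < N ] (𝟙 (moves M x) + (𝟙 (A x) + 𝟙 (B x)))            ≡⟨ ∑-distrib-+ (λ x → 𝟙 (moves M x)) _ ⟩
        covered M + ∑[ x < N ] (𝟙 (A x) + 𝟙 (B x))                  ≡⟨ cong (covered M +_) (∑-distrib-+ (λ x → 𝟙 (A x)) _) ⟩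
        covered M + (count A + count B)                              ≤⟨ +-monoˡ-≤ _ (bound m) ⟩
        k + (count A + count B)                                      ∎))
        where
        open ≤-Reasoning
        pointwise : ∀ x → 1 ≤ 𝟙 (moves M x) + (𝟙 (A x) + 𝟙 (B x))
        pointwise x with M x ≟ x | A x
        ... | yes _ | true  = s≤s z≤n
        ... | yes _ | false = s≤s z≤n
        ... | no _  | _ = s≤s z≤n

    barrier : Barrier
    barrier = record
      { S = A ; B = B ; C = C
      ; C-odd = C-odd
      ; C∩S = λ {s} {x} c → proj₁ (toWitness {a? = C? s x} c)
      ; C∩C = λ {r} {s} {x} Br Bs Cr Cs →
          let (¬Ax , r∼x) = toWitness {a? = C? r x} Cr
              (_ , s∼x) = toWitness {a? = C? s x} Cs
          in fixed⇒≡ (proj₁ (B-fixed Br)) (proj₁ (B-fixed Bs)) (∼-trans ¬Ax r∼x (∼-sym s∼x))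
      ; closed = λ {s} {x} {y} exy ¬Ax ¬Ay c → fromWitness {a? = C? s y}
          (¬Ay , ∼-trans ¬Ax (proj₂ (toWitness {a? = C? s x} c)) (edge⇒∼ exy ¬Ax ¬Ay))
      ; surplus = surplus }

  -- A vertex `a` covered by every maximum matching moves into `A`. This lowers the maximum `k` by 2
  -- and raises `count A + count A` by 2, so the inequality of `room` persists while `k` decreases.
  find-barrier : ∀ k (A : Fin N → Bool) → Bounds k (T ∘ A) → Matching (T ∘ A) M → k ≤ covered M →
                 k + (count A + count A) < N → Barrier
  find-barrier {M} k A bound m k≤M room
    with any? (λ a → ¬? (T? (A a)) ×-dec ¬? (Missing? (λ x → T? (A x)) k a a))
  ... | no none = barrier k A bound m k≤M room
          (λ x ¬Ax → decidable-stable (Missing? (λ x → T? (A x)) k x x) (λ ¬miss → none (x , ¬Ax , ¬miss)))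
  ... | yes (a , ¬Aa , ¬miss) = add k bound k≤M room ¬miss
    where
    Ma≢a : M a ≢ a
    Ma≢a Ma = ¬miss (missing m k≤M Ma Ma)
    A⁺ : Fin N → Bool
    A⁺ x = A x ∨ ⌊ a ≟ x ⌋
    A⊆A⁺ : ∀ x → T (A x) → T (A⁺ x)
    A⊆A⁺ x Ax with A x
    ... | true = tt
    A⁺a : T (A⁺ a)
    A⁺a with A a | a ≟ a
    ... | true  | _ = tt
    ... | false | yes _ = tt
    ... | false | no ¬e = contradiction refl ¬e
    A⁺⇒ : ∀ x → T (A⁺ x) → T (A x) ⊎ x ≡ a ⊎ x ≡ M a
    A⁺⇒ x h with A x | a ≟ x
    ... | true  | _ = inj₁ tt
    ... | false | yes e = inj₂ (inj₁ (sym e))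
    count-A⁺ : count A⁺ ≡ count A + 1
    count-A⁺ = trans (sum-cong-≗ pointwise)
      (trans (∑-distrib-+ (λ x → 𝟙 (A x)) _) (cong (count A +_) (count-single a)))
      where
      pointwise : ∀ x → 𝟙 (A⁺ x) ≡ 𝟙 (A x) + 𝟙 ⌊ a ≟ x ⌋
      pointwise x with A x in eq | a ≟ x
      ... | true  | yes refl = contradiction (subst T (sym eq) tt) ¬Aa
      ... | true  | no _  = refl
      ... | false | yes _ = refl
      ... | false | no _  = refl
    m⁻ : Matching (T ∘ A⁺) (isolated a M)
    m⁻ = restrict A⁺⇒ (isolate m a)
    add : ∀ k → Bounds k (T ∘ A) → k ≤ covered M → k + (count A + count A) < N →
          ¬ Missing (T ∘ A) k a a → Barrier
    add zero bound _ _ _ = contradiction (bound m)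
      (λ M≤0 → case subst (_≤ 0) (isolate-covered m Ma≢a) M≤0 of λ ())
    add (suc zero) bound _ _ _ = contradiction (bound m)
      (λ M≤1 → case subst (_≤ 1) (isolate-covered m Ma≢a) M≤1 of λ { (s≤s ()) })
    add (suc (suc j)) bound k≤M room ¬miss = find-barrier j A⁺ bound⁺ m⁻
      (+-cancelˡ-≤ 2 j _ (subst (2 + j ≤_) (isolate-covered m Ma≢a) k≤M))
      (subst (_< N) (trans (regroup j (count A)) (cong (λ c → j + (c + c)) (sym count-A⁺))) room)
      where
      regroup : ∀ j c → suc (suc j) + (c + c) ≡ j + ((c + 1) + (c + 1))
      regroup = solve-∀
      2∣j : 2 ∣ j
      2∣j = ∣m+n∣m⇒∣n (subst (2 ∣_) (≤-antisym (bound m) k≤M) (covered-even m)) (∣-refl {2})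
      -- A matching that avoids `a` covers fewer than `k = j + 2` vertices, and parity excludes
      -- `j + 1`.
      bound⁺ : Bounds j (T ∘ A⁺)
      bound⁺ {R} r with covered R ≤? j
      ... | yes R≤j = R≤j
      ... | no R≰j with suc (suc j) ≤? covered R
      ...   | yes k≤R = contradiction (missing (restrict A⊆A⁺ r) k≤R Ra Ra) ¬miss
        where Ra = avoids r a A⁺a
      ...   | no k≰R = case ∣1⇒≡1 (∣m+n∣m⇒∣n (subst (2 ∣_) R≡j+1 (covered-even r)) 2∣j) of λ ()
        where
        R≡j+1 : covered R ≡ j + 1
        R≡j+1 = trans (≤-antisym (≤-pred (≰⇒> k≰R)) (≰⇒> R≰j)) (+-comm 1 j)

  maximum : ∀ k → Bounds k (λ _ → ⊥) →
            Σ ℕ λ k → Bounds k (λ _ → ⊥) × ∃ λ M → Matching (λ _ → ⊥) M × k ≤ covered M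
  maximum zero    bound = 0 , bound , id , record
    { involutive = λ _ → refl ; edge = λ x x≢x → contradiction refl x≢x ; avoids = λ _ () } , z≤n
  maximum (suc k) bound with ∃-function? N (λ R → Matching (λ _ → ⊥) R × suc k ≤ covered R)
      (λ f≗g (m , l) → Matching-resp f≗g m , subst (suc k ≤_) (covered-resp f≗g) l)
      (λ R → Matching? (λ _ → no λ ()) R ×-dec suc k ≤? covered R)
  ... | yes (R , r , l) = suc k , bound , R , r , l
  ... | no none = maximum k (λ {R} r → ≤-pred (≰⇒> (λ l → none (R , r , l))))

  tutte : (∃ λ M → Matching (λ _ → ⊥) M × ∀ x → M x ≢ x) ⊎ Barrier
  tutte with maximum N (λ {R} _ → subst (covered R ≤_) (trans (sum-const N 1) (*-identityʳ N))
                         (sum-mono λ x → 𝟙≤1 (moves R x)))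
  ... | k , bound , M , m , k≤M with any? (λ x → M x ≟ x)
  ...   | no all-moved = inj₁ (M , m , λ x Mx → all-moved (x , Mx))
  -- The unmatched vertex `x` provides the strict inequality from which the search starts with
  -- nothing deleted.
  ...   | yes (x , Mx) = inj₂ (find-barrier k (λ _ → false) (bound ∘ restrict λ _ ())
            (restrict (λ _ ()) m) k≤M (begin-strict
              k + (count none + count none)             ≡⟨ cong (λ c → k + (c + c)) (sum-zero {N} (λ _ → refl)) ⟩
              k + 0                                     ≡⟨ +-identityʳ k ⟩
              k                                         ≤⟨ k≤M ⟩
              covered M                                 <⟨ m<m+n _ {1} (s≤s z≤n) ⟩
              covered M + 1                             ≡⟨ cong (covered M +_) (count-single x) ⟨
              covered M + count (λ y → ⌊ x ≟ y ⌋)       ≡⟨ ∑-distrib-+ (λ y → 𝟙 (moves M y)) _ ⟨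
              ∑[ y < N ] (𝟙 (moves M y) + 𝟙 ⌊ x ≟ y ⌋)  ≤⟨ sum-mono pointwise ⟩
              ∑[ y < N ] 1                              ≡⟨ trans (sum-const N 1) (*-identityʳ N) ⟩
              N                                         ∎))
    where
    open ≤-Reasoning
    none : Fin N → Bool
    none _ = false
    pointwise : ∀ y → 𝟙 (moves M y) + 𝟙 ⌊ x ≟ y ⌋ ≤ 1
    pointwise y with x ≟ y | M y ≟ y
    ... | yes refl | no ¬Mx = contradiction Mx ¬Mx
    ... | yes refl | yes _ = ≤-refl
    ... | no _ | yes _ = z≤n
    ... | no _ | no _ = ≤-refl

-- Perfect matchings from fractional ones

count-unique : ∀ {n} (P : Fin n → Bool) → (∀ {r s} → T (P r) → T (P s) → r ≡ s) → count P ≤ 1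
count-unique {n} P unique with any? (λ s → T? (P s))
... | yes (s , Ps) = subst (count P ≤_) (count-single s) (sum-mono pointwise)
  where
  pointwise : ∀ x → 𝟙 (P x) ≤ 𝟙 ⌊ s ≟ x ⌋
  pointwise x with P x in eq | s ≟ x
  ... | false | _ = z≤n
  ... | true  | yes _ = ≤-refl
  ... | true  | no s≢x = contradiction (unique Ps (subst T (sym eq) tt)) s≢x
... | no none = ≤-trans (≤-reflexive (sum-zero pointwise)) z≤n
  where
  pointwise : ∀ x → 𝟙 (P x) ≡ 0
  pointwise x with P x in eq
  ... | false = refl
  ... | true = contradiction (x , subst T (sym eq) tt) none

cut : {V : Set} → (V → Bool) → V → V → ℕ
cut U x y = 𝟙 (U x xor U y)

-- Weighted multisets of edges, as syntax: linearity of the weight is then a single induction.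
data Network (V : Set) : Set where
  edge : ℕ → V → V → Network V
  _⊕_  : Network V → Network V → Network V
  ⨁    : ∀ {n} → (Fin n → Network V) → Network V

infixr 6 _⊕_

-- For `ψ = cut U` this is the weight of a cut; for `ψ x y = g x + g y` it is the sum of the
-- weighted degrees against a test function `g`.
⟦_⟧ : ∀ {V} → Network V → (V → V → ℕ) → ℕ
⟦ edge w x y ⟧ ψ = w * ψ x y
⟦ α ⊕ β ⟧      ψ = ⟦ α ⟧ ψ + ⟦ β ⟧ ψ
⟦ ⨁ α ⟧        ψ = ∑[ i < _ ] ⟦ α i ⟧ ψ

-- Weight 0 is allowed on non-edges, since a network may list all pairs of vertices of `G`, adjacent
-- or not.
Supported : ∀ {V} → (V → V → Set) → Network V → Set
Supported E (edge w x y) = w ≡ 0 ⊎ E x y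
Supported E (α ⊕ β)      = Supported E α × Supported E β
Supported E (⨁ α)        = ∀ i → Supported E (α i)

module _ {V : Set} where

  ⟦⟧-mono : ∀ {E} (α : Network V) → Supported E α → {φ ψ : V → V → ℕ} →
            (∀ {x y} → E x y → φ x y ≤ ψ x y) → ⟦ α ⟧ φ ≤ ⟦ α ⟧ ψ
  ⟦⟧-mono (edge w x y) (inj₁ refl) φ≤ψ = z≤n
  ⟦⟧-mono (edge w x y) (inj₂ exy)  φ≤ψ = *-monoʳ-≤ w (φ≤ψ exy)
  ⟦⟧-mono (α ⊕ β)      (a , b)     φ≤ψ = +-mono-≤ (⟦⟧-mono α a φ≤ψ) (⟦⟧-mono β b φ≤ψ)
  ⟦⟧-mono (⨁ α)        a           φ≤ψ = sum-mono λ i → ⟦⟧-mono (α i) (a i) φ≤ψ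

  ⟦⟧-linear : ∀ {n} (α : Network V) (c : Fin n → ℕ) (ψ : Fin n → V → V → ℕ) →
              ∑[ s < n ] (c s * ⟦ α ⟧ (ψ s)) ≡ ⟦ α ⟧ (λ x y → ∑[ s < n ] (c s * ψ s x y))
  ⟦⟧-linear {n} (edge w x y) c ψ = trans (sum-cong-≗ λ s → swap (c s) w (ψ s x y))
                                         (sym (*-distribˡ-sum w (λ s → c s * ψ s x y)))
    where
    swap : ∀ a b d → a * (b * d) ≡ b * (a * d)
    swap = solve-∀
  ⟦⟧-linear {n} (α ⊕ β) c ψ = begin
    ∑[ s < n ] (c s * (⟦ α ⟧ (ψ s) + ⟦ β ⟧ (ψ s)))                      ≡⟨ sum-cong-≗ (λ s → *-distribˡ-+ (c s) _ _) ⟩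
    ∑[ s < n ] (c s * ⟦ α ⟧ (ψ s) + c s * ⟦ β ⟧ (ψ s))                  ≡⟨ ∑-distrib-+ (λ s → c s * ⟦ α ⟧ (ψ s)) _ ⟩
    ∑[ s < n ] (c s * ⟦ α ⟧ (ψ s)) + ∑[ s < n ] (c s * ⟦ β ⟧ (ψ s))     ≡⟨ cong₂ _+_ (⟦⟧-linear α c ψ) (⟦⟧-linear β c ψ) ⟩
    ⟦ α ⊕ β ⟧ (λ x y → ∑[ s < n ] (c s * ψ s x y))                      ∎
    where open ≡-Reasoning
  ⟦⟧-linear {n} (⨁ {m} α) c ψ = begin
    ∑[ s < n ] (c s * ∑[ i < m ] ⟦ α i ⟧ (ψ s))          ≡⟨ sum-cong-≗ (λ s → *-distribˡ-sum (c s) (λ i → ⟦ α i ⟧ (ψ s))) ⟩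
    ∑[ s < n ] ∑[ i < m ] (c s * ⟦ α i ⟧ (ψ s))          ≡⟨ ∑-comm (λ s i → c s * ⟦ α i ⟧ (ψ s)) ⟩
    ∑[ i < m ] ∑[ s < n ] (c s * ⟦ α i ⟧ (ψ s))          ≡⟨ sum-cong-≗ (λ i → ⟦⟧-linear (α i) c ψ) ⟩
    ⟦ ⨁ α ⟧ (λ x y → ∑[ s < n ] (c s * ψ s x y))         ∎
    where open ≡-Reasoning

module _ {N : ℕ} (E : Fin N → Fin N → Set) (E-sym : ∀ {x y} → E x y → E y x)
         (E? : ∀ x y → Dec (E x y)) where

  open Matchings E E-sym E?

  -- A weighting that puts 1/Λ of itself into Edmonds' perfect matching polytope yields a perfect matching:
  -- the odd classes of a barrier would have to share the load of too few vertices.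
  weighted-tutte : (α : Network (Fin N)) (Λ : ℕ) → 1 ≤ Λ → Supported E α →
    (∀ g → ⟦ α ⟧ (λ x y → g x + g y) ≤ Λ * sum g) →
    (∀ U → ¬ 2 ∣ count U → Λ ≤ ⟦ α ⟧ (cut U)) →
    ∃ λ M → Matching (λ _ → ⊥) M × ∀ x → M x ≢ x
  weighted-tutte α Λ 1≤Λ supp load odd-cuts with tutte
  ... | inj₁ perfect = perfect
  ... | inj₂ barrier = contradiction (begin-strict
      Λ * count S                                               <⟨ *-monoʳ-< Λ {{>-nonZero 1≤Λ}} surplus ⟩
      Λ * count B                                               ≡⟨ *-distribˡ-sum Λ (𝟙 ∘ B) ⟩
      ∑[ s < N ] (Λ * 𝟙 (B s))                                  ≤⟨ sum-mono crossing ⟩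
      ∑[ s < N ] (𝟙 (B s) * ⟦ α ⟧ (cut (C s)))                  ≡⟨ ⟦⟧-linear α (𝟙 ∘ B) (cut ∘ C) ⟩
      ⟦ α ⟧ (λ x y → ∑[ s < N ] (𝟙 (B s) * cut (C s) x y))      ≤⟨ ⟦⟧-mono α supp charge ⟩
      ⟦ α ⟧ (λ x y → 𝟙 (S x) + 𝟙 (S y))                         ≤⟨ load (𝟙 ∘ S) ⟩
      Λ * count S                                               ∎) (<-irrefl refl)
    where
    open Barrier barrier
    open ≤-Reasoning
    crossing : ∀ s → Λ * 𝟙 (B s) ≤ 𝟙 (B s) * ⟦ α ⟧ (cut (C s))
    crossing s with B s in eq
    ... | false = ≤-reflexive (*-zeroʳ Λ)
    ... | true  = ≤-trans (≤-reflexive (*-comm Λ 1)) (*-monoʳ-≤ 1 (odd-cuts (C s) (C-odd s (subst T (sym eq) tt))))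
    S⇒¬C : ∀ {x} → T (S x) → ∀ s → C s x ≡ false
    S⇒¬C {x} Sx s with C s x in eq
    ... | false = refl
    ... | true  = contradiction Sx (C∩S {s} (subst T (sym eq) tt))
    same : ∀ {x y} → E x y → ¬ T (S x) → ¬ T (S y) → ∀ s → cut (C s) x y ≡ 0
    same {x} {y} exy ¬Sx ¬Sy s with C s x in eqx | C s y in eqy
    ... | true  | true  = refl
    ... | false | false = refl
    ... | true  | false = ⊥-elim (subst T eqy (closed exy ¬Sx ¬Sy (subst T (sym eqx) tt)))
    ... | false | true  = ⊥-elim (subst T eqx (closed (E-sym exy) ¬Sy ¬Sx (subst T (sym eqy) tt)))
    one-class : ∀ y → ∑[ s < N ] (𝟙 (B s) * 𝟙 (C s y)) ≤ 1
    one-class y = subst (_≤ 1) (sum-cong-≗ λ s → product (B s) (C s y))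
      (count-unique (λ s → B s ∧ C s y) unique)
      where
      product : ∀ b c → 𝟙 (b ∧ c) ≡ 𝟙 b * 𝟙 c
      product true  c = sym (+-identityʳ _)
      product false c = refl
      unique : ∀ {r s} → T (B r ∧ C r y) → T (B s ∧ C s y) → r ≡ s
      unique {r} {s} p q with B r in er | C r y in fr | B s in es | C s y in fs
      ... | true | true | true | true = C∩C (subst T (sym er) tt) (subst T (sym es) tt)
                                            (subst T (sym fr) tt) (subst T (sym fs) tt)
    -- An edge outside `S` crosses the boundary of no class. An end in `S` lies in no class, and
    -- then the other end lies in at most one.
    charge : ∀ {x y} → E x y → ∑[ s < N ] (𝟙 (B s) * cut (C s) x y) ≤ 𝟙 (S x) + 𝟙 (S y)
    charge {x} {y} exy with T? (S x) | T? (S y)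
    ... | no ¬Sx | no ¬Sy = ≤-trans (≤-reflexive (sum-zero λ s →
            trans (cong (𝟙 (B s) *_) (same exy ¬Sx ¬Sy s)) (*-zeroʳ (𝟙 (B s))))) z≤n
    ... | yes Sx | _ = begin
            ∑[ s < N ] (𝟙 (B s) * cut (C s) x y)   ≡⟨ sum-cong-≗ (λ s → cong (λ b → 𝟙 (B s) * 𝟙 (b xor C s y)) (S⇒¬C Sx s)) ⟩
            ∑[ s < N ] (𝟙 (B s) * 𝟙 (C s y))       ≤⟨ one-class y ⟩
            1                                       ≤⟨ T⇒1≤𝟙 Sx ⟩
            𝟙 (S x)                                 ≤⟨ m≤m+n _ _ ⟩
            𝟙 (S x) + 𝟙 (S y)                       ∎
    ... | no _ | yes Sy = begin
            ∑[ s < N ] (𝟙 (B s) * cut (C s) x y)   ≡⟨ sum-cong-≗ (λ s → cong (λ b → 𝟙 (B s) * 𝟙 b)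
                                                        (trans (cong (C s x xor_) (S⇒¬C Sy s)) (xor-identityʳ (C s x)))) ⟩
            ∑[ s < N ] (𝟙 (B s) * 𝟙 (C s x))       ≤⟨ one-class x ⟩
            1                                       ≤⟨ T⇒1≤𝟙 Sy ⟩
            𝟙 (S y)                                 ≤⟨ m≤n+m _ _ ⟩
            𝟙 (S x) + 𝟙 (S y)                       ∎

-- The gadget graph

T⇔⇒≡ : ∀ {b c} → (T b → T c) → (T c → T b) → b ≡ c
T⇔⇒≡ {false} {false} f g = refl
T⇔⇒≡ {false} {true}  f g = ⊥-elim (g tt)
T⇔⇒≡ {true}  {false} f g = ⊥-elim (f tt)
T⇔⇒≡ {true}  {true}  f g = refl

sum-↑ : ∀ m {n} (f : Fin (m + n) → ℕ) → sum f ≡ ∑[ i < m ] f (i ↑ˡ n) + ∑[ j < n ] f (m ↑ʳ j)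
sum-↑ zero    f = refl
sum-↑ (suc m) f = trans (cong (f zero +_) (sum-↑ m (f ∘ suc))) (sym (+-assoc (f zero) _ _))

sum-combine : ∀ m {n} (f : Fin (m * n) → ℕ) → sum f ≡ ∑[ i < m ] ∑[ j < n ] f (combine i j)
sum-combine zero        f = refl
sum-combine (suc m) {n} f = trans (sum-↑ n f) (cong (∑[ j < n ] f (j ↑ˡ (m * n)) +_) (sum-combine m (f ∘ (n ↑ʳ_))))

-- Each vertex v of G becomes n ports (one for each possible neighbour), k pairs of loop ends and I inner nodes.
-- A port or a loop end is matched either along its edge of G (its loop) or to an inner node at v.
module Gadget {n : ℕ} (G : Graph n) (k I : ℕ) where

  data Node : Set where
    port  : Fin n → Fin n → Node
    loop  : Bool → Fin n → Fin k → Node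
    inner : Fin n → Fin I → Node

  Slots : ℕ
  Slots = n + ((k + k) + I)

  N : ℕ
  N = n * Slots

  slot : Fin n → Fin n ⊎ ((Fin k ⊎ Fin k) ⊎ Fin I) → Node
  slot v (inj₁ w)               = port v w
  slot v (inj₂ (inj₁ (inj₁ j))) = loop false v j
  slot v (inj₂ (inj₁ (inj₂ j))) = loop true v j
  slot v (inj₂ (inj₂ i))        = inner v i

  split : Fin Slots → Fin n ⊎ ((Fin k ⊎ Fin k) ⊎ Fin I)
  split = map₂ (map₁ (splitAt k) ∘ splitAt (k + k)) ∘ splitAt n

  decode : Fin N → Node
  decode x = slot (proj₁ (remQuot Slots x)) (split (proj₂ (remQuot {n} Slots x)))

  position : Node → Fin n × Fin Slots
  position (port v w)       = v , w ↑ˡ ((k + k) + I)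
  position (loop false v j) = v , n ↑ʳ ((j ↑ˡ k) ↑ˡ I)
  position (loop true v j)  = v , n ↑ʳ ((k ↑ʳ j) ↑ˡ I)
  position (inner v i)      = v , n ↑ʳ ((k + k) ↑ʳ i)

  encode : Node → Fin N
  encode x = combine (proj₁ (position x)) (proj₂ (position x))

  decode-combine : ∀ v s → decode (combine v s) ≡ slot v (split s)
  decode-combine v s = cong (λ p → slot (proj₁ p) (split (proj₂ p))) (remQuot-combine {n} v s)

  decode-encode : ∀ x → decode (encode x) ≡ x
  decode-encode x = trans (decode-combine (proj₁ (position x)) (proj₂ (position x))) (slot-position x)
    where
    slot-position : ∀ x → slot (proj₁ (position x)) (split (proj₂ (position x))) ≡ x
    slot-position (port v w) rewrite splitAt-↑ˡ n w ((k + k) + I) = refl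
    slot-position (loop false v j) rewrite splitAt-↑ʳ n ((k + k) + I) ((j ↑ˡ k) ↑ˡ I)
      | splitAt-↑ˡ (k + k) (j ↑ˡ k) I | splitAt-↑ˡ k j k = refl
    slot-position (loop true v j) rewrite splitAt-↑ʳ n ((k + k) + I) ((k ↑ʳ j) ↑ˡ I)
      | splitAt-↑ˡ (k + k) (k ↑ʳ j) I | splitAt-↑ʳ k k j = refl
    slot-position (inner v i) rewrite splitAt-↑ʳ n ((k + k) + I) ((k + k) ↑ʳ i)
      | splitAt-↑ʳ (k + k) I i = refl

  encode-decode : ∀ x → encode (decode x) ≡ x
  encode-decode x = trans (encode-slot (proj₁ (remQuot Slots x)) (proj₂ (remQuot {n} Slots x))) (combine-remQuot {n} Slots x)
    where
    encode-slot : ∀ v s → encode (slot v (split s)) ≡ combine v s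
    encode-slot v s with splitAt n s in eq
    ... | inj₁ w = cong (combine v) (trans (cong (join n _) (sym eq)) (join-splitAt n _ s))
    ... | inj₂ s′ with splitAt (k + k) s′ in eq′
    ...   | inj₂ i = cong (combine v) (trans (cong (n ↑ʳ_) (trans (cong (join (k + k) _) (sym eq′)) (join-splitAt (k + k) _ s′)))
                                        (trans (cong (join n _) (sym eq)) (join-splitAt n _ s)))
    ...   | inj₁ s″ with splitAt k s″ in eq″
    ...     | inj₁ j = cong (combine v) (trans (cong (λ t → n ↑ʳ (t ↑ˡ I)) (trans (cong (join k k) (sym eq″)) (join-splitAt k k s″)))
                         (trans (cong (n ↑ʳ_) (trans (cong (join (k + k) _) (sym eq′)) (join-splitAt (k + k) _ s′)))
                                        (trans (cong (join n _) (sym eq)) (join-splitAt n _ s))))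
    ...     | inj₂ j = cong (combine v) (trans (cong (λ t → n ↑ʳ (t ↑ˡ I)) (trans (cong (join k k) (sym eq″)) (join-splitAt k k s″)))
                         (trans (cong (n ↑ʳ_) (trans (cong (join (k + k) _) (sym eq′)) (join-splitAt (k + k) _ s′)))
                                        (trans (cong (join n _) (sym eq)) (join-splitAt n _ s))))

  sum-nodes : (g : Fin N → ℕ) → sum g ≡
    ∑[ v < n ] (∑[ w < n ] g (encode (port v w))
                + (∑[ j < k ] (g (encode (loop false v j)) + g (encode (loop true v j)))
                   + ∑[ i < I ] g (encode (inner v i))))
  sum-nodes g = trans (sum-combine n g) (sum-cong-≗ λ v →
    trans (sum-↑ n (λ s → g (combine v s))) (cong (∑[ w < n ] g (encode (port v w)) +_)
      (trans (sum-↑ (k + k) (λ s → g (combine v (n ↑ʳ s)))) (cong (_+ ∑[ i < I ] g (encode (inner v i)))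
        (trans (sum-↑ k (λ s → g (combine v (n ↑ʳ (s ↑ˡ I)))))
          (sym (∑-distrib-+ (λ j → g (encode (loop false v j))) _)))))))

  Adj : Node → Node → Set
  Adj (port v w)   (port v′ w′)    = (v ≡ w′ × w ≡ v′) × T (adj G v w)
  Adj (port v w)   (inner v′ i)    = v ≡ v′
  Adj (inner v i)  (port v′ w)     = v ≡ v′
  Adj (loop d v j) (loop d′ v′ j′) = (v ≡ v′ × j ≡ j′) × d ≡ not d′
  Adj (loop d v j) (inner v′ i)    = v ≡ v′
  Adj (inner v i)  (loop d v′ j)   = v ≡ v′
  Adj _            _               = ⊥

  Adj-sym : ∀ x y → Adj x y → Adj y x
  Adj-sym (port v w) (port _ _) ((refl , refl) , a) = (refl , refl) , subst T (Graph.sym G v w) a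
  Adj-sym (port _ _) (inner _ _) e = sym e
  Adj-sym (inner _ _) (port _ _) e = sym e
  Adj-sym (loop _ _ _) (loop d _ _) ((refl , refl) , refl) = (refl , refl) , sym (not-involutive d)
  Adj-sym (loop _ _ _) (inner _ _) e = sym e
  Adj-sym (inner _ _) (loop _ _ _) e = sym e

  Adj? : ∀ x y → Dec (Adj x y)
  Adj? (port v w)   (port v′ w′)    = (v ≟ w′ ×-dec w ≟ v′) ×-dec T? (adj G v w)
  Adj? (port v w)   (inner v′ i)    = v ≟ v′
  Adj? (inner v i)  (port v′ w)     = v ≟ v′
  Adj? (loop d v j) (loop d′ v′ j′) = (v ≟ v′ ×-dec j ≟ j′) ×-dec d ≟ᵇ not d′
  Adj? (loop d v j) (inner v′ i)    = v ≟ v′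
  Adj? (inner v i)  (loop d v′ j)   = v ≟ v′
  Adj? (port _ _)   (loop _ _ _)    = no λ ()
  Adj? (loop _ _ _) (port _ _)      = no λ ()
  Adj? (inner _ _)  (inner _ _)     = no λ ()

  E : Fin N → Fin N → Set
  E x y = Adj (decode x) (decode y)

  E-sym : ∀ {x y} → E x y → E y x
  E-sym = Adj-sym _ _

  E? : ∀ x y → Dec (E x y)
  E? x y = Adj? (decode x) (decode y)

  E-encode : ∀ {x y} → Adj x y → E (encode x) (encode y)
  E-encode {x} {y} a rewrite decode-encode x | decode-encode y = a

  _≟ᴺ_ : (x y : Node) → Dec (x ≡ y)
  x ≟ᴺ y = map′ (λ e → trans (sym (decode-encode x)) (trans (cong decode e) (decode-encode y))) (cong encode)
                (encode x ≟ encode y)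

  module Factor (μ : Node → Node) (μ-inv : ∀ x → μ (μ x) ≡ x) (μ-adj : ∀ x → Adj x (μ x)) where

    isPort isLoop : Node → Bool
    isPort (port _ _) = true
    isPort _          = false
    isLoop (loop _ _ _) = true
    isLoop _            = false

    F : Fin n → Fin n → Bool
    F v w = isPort (μ (port v w))

    μ-port : ∀ v w → T (F v w) → μ (port v w) ≡ port w v
    μ-port v w h with μ (port v w) | μ-adj (port v w)
    ... | port _ _ | (refl , refl) , _ = refl

    F-sub : ∀ v w → T (F v w) → T (adj G v w)
    F-sub v w h with μ (port v w) | μ-adj (port v w)
    ... | port _ _ | _ , a = a

    F-sym⇒ : ∀ v w → T (F v w) → T (F w v)
    F-sym⇒ v w h = subst (T ∘ isPort) (trans (sym (μ-inv (port v w))) (cong μ (μ-port v w h))) tt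

    F-sym : ∀ v w → F v w ≡ F w v
    F-sym v w = T⇔⇒≡ (F-sym⇒ v w) (F-sym⇒ w v)

    L : Bool → Fin n → Fin k → Bool
    L d v j = isLoop (μ (loop d v j))

    L⇒ : ∀ d v j → T (L d v j) → T (L (not d) v j)
    L⇒ d v j h with μ (loop d v j) in eq | μ-adj (loop d v j)
    ... | loop d′ _ _ | (refl , refl) , refl =
      subst (λ d″ → T (L d″ v j)) (sym (not-involutive d′))
        (subst (T ∘ isLoop) (trans (sym (μ-inv (loop (not d′) v j))) (cong μ eq)) tt)

    L-sym : ∀ v j → L false v j ≡ L true v j
    L-sym v j = T⇔⇒≡ (L⇒ false v j) (L⇒ true v j)

    hit : Node → Fin n → Fin I → ℕ
    hit x v i = 𝟙 ⌊ μ x ≟ᴺ inner v i ⌋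

    hit-sym : ∀ x v i → hit x v i ≡ 𝟙 ⌊ μ (inner v i) ≟ᴺ x ⌋
    hit-sym x v i = cong 𝟙 (⌊⌋-⇔ (μ x ≟ᴺ inner v i) (μ (inner v i) ≟ᴺ x)
      (λ e → trans (cong μ (sym e)) (μ-inv x)) (λ e → trans (cong μ (sym e)) (μ-inv (inner v i))))

    miss : ∀ {x y} → x ≢ y → 𝟙 ⌊ x ≟ᴺ y ⌋ ≡ 0
    miss {x} {y} x≢y with x ≟ᴺ y
    ... | yes e = contradiction e x≢y
    ... | no _ = refl

    count-inner : ∀ v i₀ → ∑[ i < I ] 𝟙 ⌊ inner v i₀ ≟ᴺ inner v i ⌋ ≡ 1
    count-inner v i₀ = trans (sum-cong-≗ λ i → cong 𝟙 (⌊⌋-⇔ (inner v i₀ ≟ᴺ inner v i) (i₀ ≟ i)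
      (λ { refl → refl }) (λ { refl → refl }))) (count-single i₀)

    port-row : ∀ v w → ∑[ i < I ] hit (port v w) v i + 𝟙 (F v w) ≡ 1
    port-row v w with μ (port v w) | μ-adj (port v w)
    ... | port a b  | _    = cong (_+ 1) (sum-zero {I} λ i → miss λ ())
    ... | inner _ i₀ | refl = cong (_+ 0) (count-inner v i₀)

    loop-row : ∀ d v j → ∑[ i < I ] hit (loop d v j) v i + 𝟙 (L d v j) ≡ 1
    loop-row d v j with μ (loop d v j) | μ-adj (loop d v j)
    ... | loop _ _ _ | _    = cong (_+ 1) (sum-zero {I} λ i → miss λ ())
    ... | inner _ i₀ | refl = cong (_+ 0) (count-inner v i₀)

    column : ∀ v i → ∑[ w < n ] hit (port v w) v i + ∑[ j < k ] (hit (loop false v j) v i + hit (loop true v j) v i) ≡ 1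
    column v i = trans (cong₂ _+_ (sum-cong-≗ λ w → hit-sym (port v w) v i)
                          (sum-cong-≗ λ j → cong₂ _+_ (hit-sym (loop false v j) v i) (hit-sym (loop true v j) v i)))
                       (partner (μ (inner v i)) (μ-adj (inner v i)))
      where
      partner : ∀ x → Adj (inner v i) x →
        ∑[ w < n ] 𝟙 ⌊ x ≟ᴺ port v w ⌋ + ∑[ j < k ] (𝟙 ⌊ x ≟ᴺ loop false v j ⌋ + 𝟙 ⌊ x ≟ᴺ loop true v j ⌋) ≡ 1
      partner (port _ w₀) refl = cong₂ _+_
        (trans (sum-cong-≗ λ w → cong 𝟙 (⌊⌋-⇔ (port v w₀ ≟ᴺ port v w) (w₀ ≟ w) (λ { refl → refl }) (λ { refl → refl })))
               (count-single w₀))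
        (sum-zero {k} λ j → cong₂ _+_ (miss {port v w₀} {loop false v j} λ ()) (miss {port v w₀} {loop true v j} λ ()))
      partner (loop false _ j₀) refl = cong₂ _+_ (sum-zero {n} λ w → miss {loop false v j₀} {port v w} λ ())
        (trans (sum-cong-≗ λ j → trans (cong₂ _+_
            (cong 𝟙 (⌊⌋-⇔ (loop false v j₀ ≟ᴺ loop false v j) (j₀ ≟ j) (λ { refl → refl }) (λ { refl → refl })))
            (miss {loop false v j₀} {loop true v j} λ ())) (+-identityʳ _)) (count-single j₀))
      partner (loop true _ j₀) refl = cong₂ _+_ (sum-zero {n} λ w → miss {loop true v j₀} {port v w} λ ())
        (trans (sum-cong-≗ λ j → cong₂ _+_ (miss {loop true v j₀} {loop false v j} λ ())
            (cong 𝟙 (⌊⌋-⇔ (loop true v j₀ ≟ᴺ loop true v j) (j₀ ≟ j) (λ { refl → refl }) (λ { refl → refl }))))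
          (count-single j₀))

    -- Double counting of the matching edges at the inner nodes of `v`: each inner node is on
    -- exactly one, and so is each port or loop end that is not matched along its edge of `G` or its
    -- loop.
    degree : ∀ v → I + (count (F v) + (count (L false v) + count (L false v))) ≡ n + (k + k)
    degree v = begin
      I + (count (F v) + (ℓ + ℓ))
        ≡⟨ cong₂ (λ a b → a + (count (F v) + b)) columns
             (trans (sym (∑-distrib-+ (𝟙 ∘ L false v) _)) (sum-cong-≗ λ j → cong (λ b → 𝟙 (L false v j) + 𝟙 b) (L-sym v j))) ⟩
      (P + Q) + (count (F v) + ∑[ j < k ] (𝟙 (L false v j) + 𝟙 (L true v j)))
        ≡⟨ regroup P Q (count (F v)) _ ⟩
      (P + count (F v)) + (Q + ∑[ j < k ] (𝟙 (L false v j) + 𝟙 (L true v j)))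
        ≡⟨ cong₂ _+_ (sym (∑-distrib-+ (λ w → ∑[ i < I ] hit (port v w) v i) _))
                     (sym (∑-distrib-+ (λ j → ∑[ i < I ] hit (loop false v j) v i + ∑[ i < I ] hit (loop true v j) v i) _)) ⟩
      ∑[ w < n ] (∑[ i < I ] hit (port v w) v i + 𝟙 (F v w))
        + ∑[ j < k ] ((∑[ i < I ] hit (loop false v j) v i + ∑[ i < I ] hit (loop true v j) v i) + (𝟙 (L false v j) + 𝟙 (L true v j)))
        ≡⟨ cong₂ _+_ (sum-cong-≗ (port-row v))
             (sum-cong-≗ λ j → trans (regroup (∑[ i < I ] hit (loop false v j) v i) _ (𝟙 (L false v j)) _)
                                     (cong₂ _+_ (loop-row false v j) (loop-row true v j))) ⟩
      ∑[ w < n ] 1 + ∑[ j < k ] 2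
        ≡⟨ cong₂ _+_ (trans (sum-const n 1) (*-identityʳ n)) (trans (sum-const k 2) (double k)) ⟩
      n + (k + k) ∎
      where
      open ≡-Reasoning
      ℓ = count (L false v)
      P = ∑[ w < n ] ∑[ i < I ] hit (port v w) v i
      Q = ∑[ j < k ] (∑[ i < I ] hit (loop false v j) v i + ∑[ i < I ] hit (loop true v j) v i)
      regroup : ∀ a b c d → (a + b) + (c + d) ≡ (a + c) + (b + d)
      regroup = solve-∀
      double : ∀ m → m * 2 ≡ m + m
      double = solve-∀
      columns : I ≡ P + Q
      columns = begin
        I                ≡⟨ trans (sum-const I 1) (*-identityʳ I) ⟨
        ∑[ i < I ] 1     ≡⟨ sum-cong-≗ (column v) ⟨
        ∑[ i < I ] (∑[ w < n ] hit (port v w) v i + ∑[ j < k ] (hit (loop false v j) v i + hit (loop true v j) v i))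
          ≡⟨ ∑-distrib-+ (λ i → ∑[ w < n ] hit (port v w) v i) _ ⟩
        ∑[ i < I ] ∑[ w < n ] hit (port v w) v i + ∑[ i < I ] ∑[ j < k ] (hit (loop false v j) v i + hit (loop true v j) v i)
          ≡⟨ cong₂ _+_ (∑-comm (λ i w → hit (port v w) v i))
               (trans (∑-comm (λ i j → hit (loop false v j) v i + hit (loop true v j) v i))
                      (sum-cong-≗ λ j → ∑-distrib-+ (λ i → hit (loop false v j) v i) _)) ⟩
        P + Q ∎

    -- Exactly `b` ports and loop ends at `v` are matched away from the inner nodes. Loops take an
    -- even number of these, at most `b − a`, and what remains is the degree in `F`.
    parity-factor : ∀ {a b} → a + (k + k) ≡ b → I + b ≡ n + (k + k) → ParityFactor G a b
    parity-factor {a} {b} a+2k≡b I+b≡ = record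
      { F = F ; F-sym = F-sym ; F-sub = F-sub
      ; lower = λ v → subst (a ≤_) (sym (sum-allFin (𝟙 ∘ F v)))
          (+-cancelʳ-≤ (k + k) a _ (begin
            a + (k + k)                                                 ≡⟨ a+2k≡b ⟩
            b                                                           ≡⟨ total v ⟨
            count (F v) + (count (L false v) + count (L false v))       ≤⟨ +-monoʳ-≤ (count (F v)) (+-mono-≤ (ℓ≤k v) (ℓ≤k v)) ⟩
            count (F v) + (k + k)                                       ∎))
      ; upper = λ v → subst (_≤ b) (sym (sum-allFin (𝟙 ∘ F v))) (subst (count (F v) ≤_) (total v) (m≤m+n _ _))
      ; parity = λ v → trans (cong (_% 2) (sum-allFin (𝟙 ∘ F v)))
          (trans (sym ([m+kn]%n≡m%n (count (F v)) (count (L false v)) 2))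
            (cong (_% 2) (trans (cong (count (F v) +_) (double (count (L false v)))) (total v)))) }
      where
      open ≤-Reasoning
      double : ∀ m → m * 2 ≡ m + m
      double = solve-∀
      total : ∀ v → count (F v) + (count (L false v) + count (L false v)) ≡ b
      total v = +-cancelˡ-≡ I _ _ (trans (degree v) (sym I+b≡))
      ℓ≤k : ∀ v → count (L false v) ≤ k
      ℓ≤k v = subst (count (L false v) ≤_) (trans (sum-const k 1) (*-identityʳ k)) (sum-mono λ j → 𝟙≤1 (L false v j))

-- The weighting of the gadget graph and its odd cuts

two-terms : ∀ {n} (f : Fin n → ℕ) {i j} → i ≢ j → f i + f j ≤ sum f
two-terms {n} f {i} {j} i≢j = begin
  f i + f j                                                            ≡⟨ cong₂ _+_ (sum-δ f i) (sum-δ f j) ⟨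
  ∑[ x < n ] (𝟙 ⌊ i ≟ x ⌋ * f x) + ∑[ x < n ] (𝟙 ⌊ j ≟ x ⌋ * f x)      ≡⟨ ∑-distrib-+ (λ x → 𝟙 ⌊ i ≟ x ⌋ * f x) _ ⟨
  ∑[ x < n ] (𝟙 ⌊ i ≟ x ⌋ * f x + 𝟙 ⌊ j ≟ x ⌋ * f x)                  ≤⟨ sum-mono pointwise ⟩
  sum f                                                                ∎
  where
  open ≤-Reasoning
  pointwise : ∀ x → 𝟙 ⌊ i ≟ x ⌋ * f x + 𝟙 ⌊ j ≟ x ⌋ * f x ≤ f x
  pointwise x with i ≟ x | j ≟ x
  ... | yes refl | yes refl = contradiction refl i≢j
  ... | yes _ | no _ = ≤-reflexive (trans (+-identityʳ _) (+-identityʳ (f x)))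
  ... | no _ | yes _ = ≤-reflexive (+-identityʳ (f x))
  ... | no _ | no _ = z≤n

∂ : ∀ {n} → Graph n → (Fin n → Bool) → ℕ
∂ {n} G X = ∑[ v < n ] ∑[ w < n ] 𝟙 (X v ∧ not (X w) ∧ adj G v w)

∑∑-cong : ∀ {m n} {f g : Fin m → Fin n → ℕ} → (∀ i j → f i j ≡ g i j) →
          ∑[ i < m ] ∑[ j < n ] f i j ≡ ∑[ i < m ] ∑[ j < n ] g i j
∑∑-cong f≡g = sum-cong-≗ λ i → sum-cong-≗ (f≡g i)

∑∑-mono : ∀ {m n} {f g : Fin m → Fin n → ℕ} → (∀ i j → f i j ≤ g i j) →
          ∑[ i < m ] ∑[ j < n ] f i j ≤ ∑[ i < m ] ∑[ j < n ] g i j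
∑∑-mono f≤g = sum-mono λ i → sum-mono (f≤g i)

∑∑-distrib-+ : ∀ {m n} (f g : Fin m → Fin n → ℕ) →
  ∑[ i < m ] ∑[ j < n ] (f i j + g i j) ≡ ∑[ i < m ] ∑[ j < n ] f i j + ∑[ i < m ] ∑[ j < n ] g i j
∑∑-distrib-+ f g = trans (sum-cong-≗ λ i → ∑-distrib-+ (f i) (g i)) (∑-distrib-+ (λ i → sum (f i)) _)

*-distribˡ-∑∑ : ∀ {m n} x (f : Fin m → Fin n → ℕ) →
  x * (∑[ i < m ] ∑[ j < n ] f i j) ≡ ∑[ i < m ] ∑[ j < n ] (x * f i j)
*-distribˡ-∑∑ x f = trans (*-distribˡ-sum x (λ i → sum (f i))) (sum-cong-≗ λ i → *-distribˡ-sum x (f i))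

-- An edge of G has weight c/Y and a loop z/Y; a port or loop end spreads its remaining weight evenly over the
-- I inner nodes. Everything is scaled by 2 I Y, the 2 because an edge of G is listed once from each end.
module Weighting {n : ℕ} (G : Graph n) (k I Y c c′ z z′ : ℕ)
  (c+c′≡Y : c + c′ ≡ Y) (z+z′≡Y : z + z′ ≡ Y)
  (balance : ∀ v → ∑[ w < n ] (if adj G v w then c′ else Y) + k * (z′ + z′) ≡ I * Y) where

  open Gadget G k I

  -- A port without an edge of `G` gives its whole weight to the inner nodes. The factor `I` in `ε`
  -- is part of the scaling; its factor 2 comes from listing an edge at both ends.
  ω ε : Fin n → Fin n → ℕ
  ω v w = if adj G v w then c′ else Y
  ε v w = if adj G v w then I * c else 0

  ε-sym : ∀ v w → ε v w ≡ ε w v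
  ε-sym v w = cong (λ b → if b then I * c else 0) (Graph.sym G v w)

  ports : Fin n → Network (Fin N)
  ports v = ⨁ λ w → ⨁ λ i → edge (2 * ω v w) (encode (port v w)) (encode (inner v i))

  loops : Fin n → Network (Fin N)
  loops v = ⨁ λ j → ⨁ λ i → edge (2 * z′) (encode (loop false v j)) (encode (inner v i))
                           ⊕ edge (2 * z′) (encode (loop true v j)) (encode (inner v i))

  port-edges : Fin n → Network (Fin N)
  port-edges v = ⨁ λ w → edge (ε v w) (encode (port v w)) (encode (port w v))

  loop-edges : Fin n → Network (Fin N)
  loop-edges v = ⨁ λ j → edge (2 * (I * z)) (encode (loop false v j)) (encode (loop true v j))

  weights : Network (Fin N)
  weights = ⨁ λ v → (ports v ⊕ loops v) ⊕ (port-edges v ⊕ loop-edges v)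

  Λ : ℕ
  Λ = 2 * (I * Y)

  supported : Supported E weights
  supported v =
    ((λ w i → inj₂ (E-encode {port v w} {inner v i} refl)) ,
     (λ j i → inj₂ (E-encode {loop false v j} {inner v i} refl) , inj₂ (E-encode {loop true v j} {inner v i} refl))) ,
    (λ w → external w) ,
    (λ j → inj₂ (E-encode {loop false v j} {loop true v j} ((refl , refl) , refl)))
    where
    external : ∀ w → ε v w ≡ 0 ⊎ E (encode (port v w)) (encode (port w v))
    external w with adj G v w in eq
    ... | true  = inj₂ (E-encode {port v w} {port w v} ((refl , refl) , subst T (sym eq) tt))
    ... | false = inj₁ refl

  -- The left side is the load of a single inner node at `v`.
  hub-balance : ∀ v → ∑[ w < n ] (2 * ω v w) + k * (2 * z′ + 2 * z′) ≡ Λ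
  hub-balance v = trans (cong₂ _+_ (sym (*-distribˡ-sum 2 (ω v))) (pull k z′))
    (trans (sym (*-distribˡ-+ 2 (sum (ω v)) _)) (cong (2 *_) (balance v)))
    where
    pull : ∀ k z → k * (2 * z + 2 * z) ≡ 2 * (k * (z + z))
    pull = solve-∀

  -- With `g` arbitrary, this says that every node carries load exactly `Λ`, without computing the
  -- load node by node.
  load : ∀ g → ⟦ weights ⟧ (λ x y → g x + g y) ≡ Λ * sum g
  load g = begin
    ∑[ v < n ] ((⟦ ports v ⟧ φ + ⟦ loops v ⟧ φ) + (⟦ port-edges v ⟧ φ + ⟦ loop-edges v ⟧ φ))
      ≡⟨ trans (∑-distrib-+ (λ v → ⟦ ports v ⟧ φ + ⟦ loops v ⟧ φ) _)
           (cong (∑[ v < n ] (⟦ ports v ⟧ φ + ⟦ loops v ⟧ φ) +_) (∑-distrib-+ (λ v → ⟦ port-edges v ⟧ φ) _)) ⟩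
    ∑[ v < n ] (⟦ ports v ⟧ φ + ⟦ loops v ⟧ φ) + (∑[ v < n ] ⟦ port-edges v ⟧ φ + ∑[ v < n ] ⟦ loop-edges v ⟧ φ)
      ≡⟨ cong (λ s → ∑[ v < n ] (⟦ ports v ⟧ φ + ⟦ loops v ⟧ φ) + (s + ∑[ v < n ] ⟦ loop-edges v ⟧ φ)) external ⟩
    ∑[ v < n ] (⟦ ports v ⟧ φ + ⟦ loops v ⟧ φ) + (∑[ v < n ] ∑[ w < n ] (2 * ε v w * gp v w) + ∑[ v < n ] ⟦ loop-edges v ⟧ φ)
      ≡⟨ sym (trans (∑-distrib-+ (λ v → ⟦ ports v ⟧ φ + ⟦ loops v ⟧ φ) _)
           (cong (∑[ v < n ] (⟦ ports v ⟧ φ + ⟦ loops v ⟧ φ) +_) (∑-distrib-+ (λ v → ∑[ w < n ] (2 * ε v w * gp v w)) _))) ⟩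
    ∑[ v < n ] ((⟦ ports v ⟧ φ + ⟦ loops v ⟧ φ) + (∑[ w < n ] (2 * ε v w * gp v w) + ⟦ loop-edges v ⟧ φ))
      ≡⟨ sum-cong-≗ at ⟩
    ∑[ v < n ] (Λ * (∑[ w < n ] gp v w + (∑[ j < k ] (gl false v j + gl true v j) + Gi v)))
      ≡⟨ *-distribˡ-sum Λ (λ v → ∑[ w < n ] gp v w + (∑[ j < k ] (gl false v j + gl true v j) + Gi v)) ⟨
    Λ * ∑[ v < n ] (∑[ w < n ] gp v w + (∑[ j < k ] (gl false v j + gl true v j) + Gi v))
      ≡⟨ cong (Λ *_) (sum-nodes g) ⟨
    Λ * sum g ∎
    where
    open ≡-Reasoning
    φ : Fin N → Fin N → ℕ
    φ x y = g x + g y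
    gp : Fin n → Fin n → ℕ
    gp v w = g (encode (port v w))
    gl : Bool → Fin n → Fin k → ℕ
    gl d v j = g (encode (loop d v j))
    gi : Fin n → Fin I → ℕ
    gi v i = g (encode (inner v i))
    Gi : Fin n → ℕ
    Gi v = ∑[ i < I ] gi v i
    spread : ∀ a x v → ∑[ i < I ] (a * (x + gi v i)) ≡ I * (a * x) + a * Gi v
    spread a x v = trans (sum-cong-≗ λ i → *-distribˡ-+ a x (gi v i))
      (trans (∑-distrib-+ (λ _ → a * x) (λ i → a * gi v i)) (cong₂ _+_ (sum-const I (a * x)) (sym (*-distribˡ-sum a (gi v)))))
    -- Because an edge is listed from both ends, the share of `port w v` can be moved to the row of
    -- `w`; each port then collects `2 * ε`.
    external : ∑[ v < n ] ⟦ port-edges v ⟧ φ ≡ ∑[ v < n ] ∑[ w < n ] (2 * ε v w * gp v w)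
    external = begin
      ∑[ v < n ] ∑[ w < n ] (ε v w * (gp v w + gp w v))
        ≡⟨ ∑∑-cong (λ v w → *-distribˡ-+ (ε v w) (gp v w) (gp w v)) ⟩
      ∑[ v < n ] ∑[ w < n ] (ε v w * gp v w + ε v w * gp w v)
        ≡⟨ ∑∑-distrib-+ (λ v w → ε v w * gp v w) (λ v w → ε v w * gp w v) ⟩
      ∑[ v < n ] ∑[ w < n ] (ε v w * gp v w) + ∑[ v < n ] ∑[ w < n ] (ε v w * gp w v)
        ≡⟨ cong (∑[ v < n ] ∑[ w < n ] (ε v w * gp v w) +_)
             (trans (∑-comm (λ v w → ε v w * gp w v)) (∑∑-cong λ w v → cong (_* gp w v) (ε-sym v w))) ⟩
      ∑[ v < n ] ∑[ w < n ] (ε v w * gp v w) + ∑[ v < n ] ∑[ w < n ] (ε v w * gp v w)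
        ≡⟨ ∑∑-distrib-+ (λ v w → ε v w * gp v w) (λ v w → ε v w * gp v w) ⟨
      ∑[ v < n ] ∑[ w < n ] (ε v w * gp v w + ε v w * gp v w)
        ≡⟨ ∑∑-cong (λ v w → twice (ε v w) (gp v w)) ⟩
      ∑[ v < n ] ∑[ w < n ] (2 * ε v w * gp v w) ∎
      where
      twice : ∀ a b → a * b + a * b ≡ 2 * a * b
      twice = solve-∀
    at-port : ∀ v w → I * (2 * ω v w * gp v w) + 2 * ε v w * gp v w ≡ Λ * gp v w
    at-port v w with adj G v w
    ... | true  = trans (lemma I c c′ (gp v w)) (cong (λ y → 2 * (I * y) * gp v w) c+c′≡Y)
      where
      lemma : ∀ I c c′ g → I * (2 * c′ * g) + 2 * (I * c) * g ≡ 2 * (I * (c + c′)) * g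
      lemma = solve-∀
    ... | false = lemma I Y (gp v w)
      where
      lemma : ∀ I Y g → I * (2 * Y * g) + 2 * 0 * g ≡ 2 * (I * Y) * g
      lemma = solve-∀
    at-loop : ∀ v j → (I * (2 * z′ * gl false v j) + I * (2 * z′ * gl true v j)) + 2 * (I * z) * (gl false v j + gl true v j)
                      ≡ Λ * (gl false v j + gl true v j)
    at-loop v j = trans (lemma I z z′ (gl false v j) (gl true v j))
                        (cong (λ y → 2 * (I * y) * (gl false v j + gl true v j)) z+z′≡Y)
      where
      lemma : ∀ I z z′ g h → (I * (2 * z′ * g) + I * (2 * z′ * h)) + 2 * (I * z) * (g + h) ≡ 2 * (I * (z + z′)) * (g + h)
      lemma = solve-∀
    ports-load : ∀ v → ⟦ ports v ⟧ φ ≡ ∑[ w < n ] (I * (2 * ω v w * gp v w)) + ∑[ w < n ] (2 * ω v w) * Gi v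
    ports-load v = trans (sum-cong-≗ λ w → spread (2 * ω v w) (gp v w) v)
      (trans (∑-distrib-+ (λ w → I * (2 * ω v w * gp v w)) _)
        (cong (∑[ w < n ] (I * (2 * ω v w * gp v w)) +_) (sym (*-distribʳ-sum (Gi v) (λ w → 2 * ω v w)))))
    loops-load : ∀ v → ⟦ loops v ⟧ φ ≡
      ∑[ j < k ] (I * (2 * z′ * gl false v j) + I * (2 * z′ * gl true v j)) + k * (2 * z′ + 2 * z′) * Gi v
    loops-load v = trans (sum-cong-≗ λ j →
        trans (∑-distrib-+ (λ i → 2 * z′ * (gl false v j + gi v i)) _)
          (trans (cong₂ _+_ (spread (2 * z′) (gl false v j) v) (spread (2 * z′) (gl true v j) v))
                 (regroup (I * (2 * z′ * gl false v j)) (I * (2 * z′ * gl true v j)) z′ (Gi v))))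
      (trans (∑-distrib-+ (λ j → I * (2 * z′ * gl false v j) + I * (2 * z′ * gl true v j)) _)
        (cong (∑[ j < k ] (I * (2 * z′ * gl false v j) + I * (2 * z′ * gl true v j)) +_)
          (trans (sum-const k ((2 * z′ + 2 * z′) * Gi v)) (sym (*-assoc k (2 * z′ + 2 * z′) (Gi v))))))
      where
      regroup : ∀ a b z g → (a + 2 * z * g) + (b + 2 * z * g) ≡ (a + b) + (2 * z + 2 * z) * g
      regroup = solve-∀
    at : ∀ v → (⟦ ports v ⟧ φ + ⟦ loops v ⟧ φ) + (∑[ w < n ] (2 * ε v w * gp v w) + ⟦ loop-edges v ⟧ φ)
             ≡ Λ * (∑[ w < n ] gp v w + (∑[ j < k ] (gl false v j + gl true v j) + Gi v))
    at v = begin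
      (⟦ ports v ⟧ φ + ⟦ loops v ⟧ φ) + (∑[ w < n ] (2 * ε v w * gp v w) + ⟦ loop-edges v ⟧ φ)
        ≡⟨ cong (_+ (∑[ w < n ] (2 * ε v w * gp v w) + ⟦ loop-edges v ⟧ φ)) (cong₂ _+_ (ports-load v) (loops-load v)) ⟩
      ((P + W * Gi v) + (L + Z * Gi v)) + (P′ + L′)
        ≡⟨ regroup P W (Gi v) L Z P′ L′ ⟩
      (P + P′) + ((L + L′) + (W + Z) * Gi v)
        ≡⟨ cong₂ _+_ (trans (sym (∑-distrib-+ (λ w → I * (2 * ω v w * gp v w)) _))
                       (trans (sum-cong-≗ (at-port v)) (sym (*-distribˡ-sum Λ (gp v)))))
             (cong₂ _+_ (trans (sym (∑-distrib-+ (λ j → I * (2 * z′ * gl false v j) + I * (2 * z′ * gl true v j)) _))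
                          (trans (sum-cong-≗ (at-loop v)) (sym (*-distribˡ-sum Λ (λ j → gl false v j + gl true v j)))))
                        (cong (_* Gi v) (hub-balance v))) ⟩
      Λ * ∑[ w < n ] gp v w + (Λ * ∑[ j < k ] (gl false v j + gl true v j) + Λ * Gi v)
        ≡⟨ cong (Λ * ∑[ w < n ] gp v w +_) (*-distribˡ-+ Λ (∑[ j < k ] (gl false v j + gl true v j)) (Gi v)) ⟨
      Λ * ∑[ w < n ] gp v w + Λ * (∑[ j < k ] (gl false v j + gl true v j) + Gi v)
        ≡⟨ *-distribˡ-+ Λ (∑[ w < n ] gp v w) _ ⟨
      Λ * (∑[ w < n ] gp v w + (∑[ j < k ] (gl false v j + gl true v j) + Gi v)) ∎
      where
      P  = ∑[ w < n ] (I * (2 * ω v w * gp v w))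
      W  = ∑[ w < n ] (2 * ω v w)
      L  = ∑[ j < k ] (I * (2 * z′ * gl false v j) + I * (2 * z′ * gl true v j))
      Z  = k * (2 * z′ + 2 * z′)
      P′ = ∑[ w < n ] (2 * ε v w * gp v w)
      L′ = ⟦ loop-edges v ⟧ φ
      regroup : ∀ p w g l z p′ l′ → ((p + w * g) + (l + z * g)) + (p′ + l′) ≡ (p + p′) + ((l + l′) + (w + z) * g)
      regroup = solve-∀

xor-differs : ∀ b {c d} → c ≢ d → 1 ≤ 𝟙 (b xor c) + 𝟙 (b xor d)
xor-differs b {true}  {true}  c≢d = contradiction refl c≢d
xor-differs b {false} {false} c≢d = contradiction refl c≢d
xor-differs true  {true}  {false} _ = ≤-refl
xor-differs true  {false} {true}  _ = ≤-refl
xor-differs false {true}  {false} _ = ≤-refl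
xor-differs false {false} {true}  _ = ≤-refl

xor-true : ∀ {b c} → b ≢ c → 𝟙 (b xor c) ≡ 1
xor-true {true}  {true}  b≢c = contradiction refl b≢c
xor-true {true}  {false} _ = refl
xor-true {false} {true}  _ = refl
xor-true {false} {false} b≢c = contradiction refl b≢c

-- κ is the weight of the cut U. If every hub has its inner nodes on one side, let X be the set of hubs inside U; a
-- port is wrong if it is not on the side of its hub. The wrong ports that cost less than Λ by themselves either come in
-- pairs joined by an edge within a side of X, or sit at one end of an edge leaving X, which is then called flipped.
module OddCut {n : ℕ} (G : Graph n) (k I Y c c′ z z′ b : ℕ)
  (c+c′≡Y : c + c′ ≡ Y) (z+z′≡Y : z + z′ ≡ Y)
  (balance : ∀ v → ∑[ w < n ] (if adj G v w then c′ else Y) + k * (z′ + z′) ≡ I * Y)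
  (I+b≡ : I + b ≡ n + (k + k)) (i₀ : Fin I)
  (cut-condition : ∀ X p q → p + q ≡ ∂ G X → ¬ 2 ∣ q + b * count X → Y ≤ p * c + q * c′)
  (U : Fin (Gadget.N G k I) → Bool) where

  open Gadget G k I
  open Weighting G k I Y c c′ z z′ c+c′≡Y z+z′≡Y balance

  p : Fin n → Fin n → Bool
  p v w = U (encode (port v w))

  l : Bool → Fin n → Fin k → Bool
  l d v j = U (encode (loop d v j))

  q : Fin n → Fin I → Bool
  q v i = U (encode (inner v i))

  κ : ℕ
  κ = ⟦ weights ⟧ (cut U)

  hub outer : Fin n → ℕ
  hub v   = ⟦ ports v ⟧ (cut U) + ⟦ loops v ⟧ (cut U)
  outer v = ⟦ port-edges v ⟧ (cut U) + ⟦ loop-edges v ⟧ (cut U)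

  hub≤κ : ∀ v → hub v ≤ κ
  hub≤κ v = ≤-trans (m≤m+n (hub v) (outer v)) (term≤sum (λ v → hub v + outer v) v)

  -- A hub whose inner nodes lie on both sides already costs Λ.
  mixed-hub : ∀ v i → q v i ≢ q v i₀ → Λ ≤ κ
  mixed-hub v i q≢ = begin
    Λ                                                        ≡⟨ hub-balance v ⟨
    ∑[ w < n ] (2 * ω v w) + k * (2 * z′ + 2 * z′)           ≡⟨ cong (∑[ w < n ] (2 * ω v w) +_) (sum-const k _) ⟨
    ∑[ w < n ] (2 * ω v w) + ∑[ j < k ] (2 * z′ + 2 * z′)    ≤⟨ +-mono-≤ (sum-mono λ w → spread (2 * ω v w) (p v w)) (sum-mono loop-end) ⟩
    hub v                                                    ≤⟨ hub≤κ v ⟩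
    κ                                                        ∎
    where
    open ≤-Reasoning
    i≢i₀ : i ≢ i₀
    i≢i₀ refl = q≢ refl
    -- Every port and loop end is separated from `inner v i` or from `inner v i₀`, so it has a cut
    -- edge into the hub. One such edge for each adds up to the load of an inner node, which is `Λ`.
    spread : ∀ a t → a ≤ ∑[ i < I ] (a * 𝟙 (t xor q v i))
    spread a t = begin
      a                                              ≡⟨ *-identityʳ a ⟨
      a * 1                                          ≤⟨ *-monoʳ-≤ a (xor-differs t q≢) ⟩
      a * (𝟙 (t xor q v i) + 𝟙 (t xor q v i₀))       ≤⟨ *-monoʳ-≤ a (two-terms (λ i → 𝟙 (t xor q v i)) i≢i₀) ⟩
      a * ∑[ i < I ] 𝟙 (t xor q v i)                 ≡⟨ *-distribˡ-sum a (λ i → 𝟙 (t xor q v i)) ⟩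
      ∑[ i < I ] (a * 𝟙 (t xor q v i))               ∎
    loop-end : ∀ j → 2 * z′ + 2 * z′ ≤ ∑[ i < I ] (2 * z′ * 𝟙 (l false v j xor q v i) + 2 * z′ * 𝟙 (l true v j xor q v i))
    loop-end j = ≤-trans (+-mono-≤ (spread (2 * z′) (l false v j)) (spread (2 * z′) (l true v j)))
      (≤-reflexive (sym (∑-distrib-+ (λ i → 2 * z′ * 𝟙 (l false v j xor q v i)) _)))

  module Pure (q≡ : ∀ v i → q v i ≡ q v i₀) where

    X : Fin n → Bool
    X v = q v i₀

    wrong : Fin n → Fin n → ℕ
    wrong v w = 𝟙 (p v w xor X v)

    spread : ∀ a t v → ∑[ i < I ] (a * 𝟙 (t xor q v i)) ≡ I * (a * 𝟙 (t xor X v))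
    spread a t v = trans (sum-cong-≗ λ i → cong (λ b → a * 𝟙 (t xor b)) (q≡ v i)) (sum-const I _)

    ports-cut : ∀ v → ⟦ ports v ⟧ (cut U) ≡ ∑[ w < n ] (I * (2 * ω v w * wrong v w))
    ports-cut v = sum-cong-≗ λ w → spread (2 * ω v w) (p v w) v

    loops-cut : ∀ v → ⟦ loops v ⟧ (cut U) ≡
      ∑[ j < k ] (I * (2 * z′ * 𝟙 (l false v j xor X v)) + I * (2 * z′ * 𝟙 (l true v j xor X v)))
    loops-cut v = sum-cong-≗ λ j → trans (∑-distrib-+ (λ i → 2 * z′ * 𝟙 (l false v j xor q v i)) _)
      (cong₂ _+_ (spread (2 * z′) (l false v j) v) (spread (2 * z′) (l true v j) v))

    port≤hub : ∀ v w → I * (2 * ω v w * wrong v w) ≤ hub v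
    port≤hub v w = begin
      I * (2 * ω v w * wrong v w)                  ≤⟨ term≤sum (λ w → I * (2 * ω v w * wrong v w)) w ⟩
      ∑[ w < n ] (I * (2 * ω v w * wrong v w))     ≡⟨ ports-cut v ⟨
      ⟦ ports v ⟧ (cut U)                          ≤⟨ m≤m+n _ _ ⟩
      hub v                                        ∎
      where open ≤-Reasoning

    -- Here, as in `bad-port` and `bad-edge`, some wrong node has all of its edges cut, and these
    -- weigh its full load `Λ`.
    bad-loop : ∀ v j → l false v j ≢ l true v j → Λ ≤ κ
    bad-loop v j l≢ = begin
      2 * (I * Y)                                       ≡⟨ cong (λ y → 2 * (I * y)) z+z′≡Y ⟨
      2 * (I * (z + z′))                                ≡⟨ rearrange I z z′ ⟩
      I * (2 * z′) * 1 + 2 * (I * z) * 1                ≤⟨ +-mono-≤ (*-monoʳ-≤ (I * (2 * z′)) ends-differ) (≤-reflexive (cong (2 * (I * z) *_) (sym (xor-true l≢)))) ⟩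
      I * (2 * z′) * (𝟙 (l false v j xor X v) + 𝟙 (l true v j xor X v)) + 2 * (I * z) * 𝟙 (l false v j xor l true v j)
        ≡⟨ cong (_+ 2 * (I * z) * 𝟙 (l false v j xor l true v j)) (distribute I (2 * z′) (𝟙 (l false v j xor X v)) _) ⟩
      (I * (2 * z′ * 𝟙 (l false v j xor X v)) + I * (2 * z′ * 𝟙 (l true v j xor X v))) + 2 * (I * z) * 𝟙 (l false v j xor l true v j)
        ≤⟨ +-mono-≤ (term≤sum (λ j → I * (2 * z′ * 𝟙 (l false v j xor X v)) + I * (2 * z′ * 𝟙 (l true v j xor X v))) j)
                    (term≤sum (λ j → 2 * (I * z) * 𝟙 (l false v j xor l true v j)) j) ⟩
      _ ≡⟨ cong (_+ ⟦ loop-edges v ⟧ (cut U)) (loops-cut v) ⟨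
      ⟦ loops v ⟧ (cut U) + ⟦ loop-edges v ⟧ (cut U)    ≤⟨ +-mono-≤ (m≤n+m _ (⟦ ports v ⟧ (cut U))) (m≤n+m _ (⟦ port-edges v ⟧ (cut U))) ⟩
      hub v + outer v                                   ≤⟨ term≤sum (λ v → hub v + outer v) v ⟩
      κ                                                 ∎
      where
      open ≤-Reasoning
      rearrange : ∀ I z z′ → 2 * (I * (z + z′)) ≡ I * (2 * z′) * 1 + 2 * (I * z) * 1
      rearrange = solve-∀
      distribute : ∀ I a s t → I * a * (s + t) ≡ I * (a * s) + I * (a * t)
      distribute = solve-∀
      ends-differ : 1 ≤ 𝟙 (l false v j xor X v) + 𝟙 (l true v j xor X v)
      ends-differ with X v
      ... | x = subst (1 ≤_) (cong₂ _+_ (cong 𝟙 (xor-comm x (l false v j))) (cong 𝟙 (xor-comm x (l true v j))))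
                      (xor-differs x l≢)

    bad-port : ∀ v w → adj G v w ≡ false → p v w ≢ X v → Λ ≤ κ
    bad-port v w nonadj p≢ = begin
      2 * (I * Y)                      ≡⟨ rearrange I Y ⟩
      I * (2 * Y * 1)                  ≡⟨ cong₂ (λ y t → I * (2 * y * t)) (cong (λ a → if a then c′ else Y) nonadj) (xor-true p≢) ⟨
      I * (2 * ω v w * wrong v w)      ≤⟨ port≤hub v w ⟩
      hub v                            ≤⟨ hub≤κ v ⟩
      κ                                ∎
      where
      open ≤-Reasoning
      rearrange : ∀ I Y → 2 * (I * Y) ≡ I * (2 * Y * 1)
      rearrange = solve-∀

    κ-split : κ ≡ ∑[ v < n ] hub v + ∑[ v < n ] outer v
    κ-split = ∑-distrib-+ hub outer

    edge-cost : Fin n → Fin n → ℕ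
    edge-cost v w = ε v w * 𝟙 (p v w xor p w v)

    edges≤outer : ∑[ v < n ] ∑[ w < n ] edge-cost v w ≤ ∑[ v < n ] outer v
    edges≤outer = sum-mono {n} λ v → m≤m+n (⟦ port-edges v ⟧ (cut U)) _

    bad-edge : ∀ v w → adj G v w ≡ true → p v w ≢ X v → p v w ≢ p w v → Λ ≤ κ
    bad-edge v w a p≢X p≢p = begin
      2 * (I * Y)                                        ≡⟨ cong (λ y → 2 * (I * y)) c+c′≡Y ⟨
      2 * (I * (c + c′))                                 ≡⟨ rearrange I c c′ ⟩
      I * (2 * c′ * 1) + (I * c * 1 + I * c * 1)         ≡⟨ cong₂ _+_ (cong₂ (λ y t → I * (2 * y * t)) (sym ω≡) (sym (xor-true p≢X)))
                                                              (cong₂ _+_ (cong₂ _*_ (sym ε≡) (sym (xor-true p≢p)))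
                                                                (cong₂ _*_ (trans (sym ε≡) (ε-sym v w)) (sym (xor-true (p≢p ∘ sym))))) ⟩
      I * (2 * ω v w * wrong v w) + (edge-cost v w + edge-cost w v)
        ≤⟨ +-mono-≤ (≤-trans (port≤hub v w) (term≤sum hub v))
             (+-mono-≤ (term≤sum (edge-cost v) w) (term≤sum (edge-cost w) v)) ⟩
      ∑[ v < n ] hub v + (∑[ x < n ] edge-cost v x + ∑[ x < n ] edge-cost w x)
        ≤⟨ +-monoʳ-≤ (∑[ v < n ] hub v) (two-terms (λ v → ∑[ x < n ] edge-cost v x) v≢w) ⟩
      ∑[ v < n ] hub v + ∑[ v < n ] ∑[ x < n ] edge-cost v x
        ≤⟨ +-monoʳ-≤ (∑[ v < n ] hub v) edges≤outer ⟩
      ∑[ v < n ] hub v + ∑[ v < n ] outer v              ≡⟨ κ-split ⟨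
      κ                                                  ∎
      where
      open ≤-Reasoning
      rearrange : ∀ I c c′ → 2 * (I * (c + c′)) ≡ I * (2 * c′ * 1) + (I * c * 1 + I * c * 1)
      rearrange = solve-∀
      ω≡ : ω v w ≡ c′
      ω≡ = cong (λ a → if a then c′ else Y) a
      ε≡ : ε v w ≡ I * c
      ε≡ = cong (λ a → if a then I * c else 0) a
      v≢w : v ≢ w
      v≢w refl = case trans (sym a) (loopless G v) of λ ()

    module Good (nonadj-right : ∀ v w → adj G v w ≡ false → p v w ≡ X v)
                (loops-agree : ∀ v j → l false v j ≡ l true v j)
                (wrong-uncut : ∀ v w → adj G v w ≡ true → p v w ≢ X v → p v w ≡ p w v) where

      leaves : Fin n → Fin n → Bool
      leaves v w = X v ∧ not (X w)

      same : Fin n → Fin n → ℕ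
      same v w = 𝟙 (not (X v xor X w)) * wrong v w

      flipped straight : Fin n → Fin n → ℕ
      flipped v w  = 𝟙 (leaves v w) * (wrong v w + wrong w v)
      straight v w = 𝟙 (leaves v w ∧ (adj G v w ∧ (p v w ∧ not (p w v))))

      Q P W : ℕ
      Q = ∑[ v < n ] ∑[ w < n ] flipped v w
      P = ∑[ v < n ] ∑[ w < n ] straight v w
      W = ∑[ v < n ] ∑[ w < n ] wrong v w

      -- On an edge leaving `X`, two right ports lie on different sides of `U`, which makes the edge
      -- straight. If a port is wrong, the edge is uncut, so the other port is right and the edge
      -- counts once as flipped. Ports of non-adjacent pairs are never wrong.
      boundary : P + Q ≡ ∂ G X
      boundary = trans (sym (∑∑-distrib-+ straight flipped)) (∑∑-cong λ v w →
          pointwise (X v) (X w) (adj G v w) (p v w) (p w v) (nonadj-right v w)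
            (nonadj-right w v ∘ trans (Graph.sym G w v)) (wrong-uncut v w))
        where
        pointwise : ∀ x y a s t → (a ≡ false → s ≡ x) → (a ≡ false → t ≡ y) → (a ≡ true → s ≢ x → s ≡ t) →
          𝟙 ((x ∧ not y) ∧ (a ∧ (s ∧ not t))) + 𝟙 (x ∧ not y) * (𝟙 (s xor x) + 𝟙 (t xor y)) ≡ 𝟙 (x ∧ not y ∧ a)
        pointwise false y a s t _ _ _ = refl
        pointwise true true a s t _ _ _ = refl
        pointwise true false false s t h h′ _ rewrite h refl | h′ refl = refl
        pointwise true false true true  true  _ _ _ = refl
        pointwise true false true true  false _ _ _ = refl
        pointwise true false true false false _ _ _ = refl
        pointwise true false true false true  _ _ h = contradiction (h refl λ ()) λ ()

      ∑-cross : ∑[ v < n ] ∑[ w < n ] (𝟙 (leaves v w) * wrong v w + 𝟙 (leaves w v) * wrong v w) ≡ Q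
      ∑-cross = begin
        ∑[ v < n ] ∑[ w < n ] (𝟙 (leaves v w) * wrong v w + 𝟙 (leaves w v) * wrong v w)
          ≡⟨ ∑∑-distrib-+ (λ v w → 𝟙 (leaves v w) * wrong v w) (λ v w → 𝟙 (leaves w v) * wrong v w) ⟩
        ∑[ v < n ] ∑[ w < n ] (𝟙 (leaves v w) * wrong v w) + ∑[ v < n ] ∑[ w < n ] (𝟙 (leaves w v) * wrong v w)
          ≡⟨ cong (∑[ v < n ] ∑[ w < n ] (𝟙 (leaves v w) * wrong v w) +_) (∑-comm (λ v w → 𝟙 (leaves w v) * wrong v w)) ⟩
        ∑[ v < n ] ∑[ w < n ] (𝟙 (leaves v w) * wrong v w) + ∑[ v < n ] ∑[ w < n ] (𝟙 (leaves v w) * wrong w v)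
          ≡⟨ ∑∑-distrib-+ (λ v w → 𝟙 (leaves v w) * wrong v w) (λ v w → 𝟙 (leaves v w) * wrong w v) ⟨
        ∑[ v < n ] ∑[ w < n ] (𝟙 (leaves v w) * wrong v w + 𝟙 (leaves v w) * wrong w v)
          ≡⟨ ∑∑-cong (λ v w → sym (*-distribˡ-+ (𝟙 (leaves v w)) (wrong v w) (wrong w v))) ⟩
        Q ∎
        where open ≡-Reasoning

      wrong-split : W ≡ ∑[ v < n ] ∑[ w < n ] same v w + Q
      wrong-split = trans (∑∑-cong λ v w → pointwise (X v) (X w) (wrong v w))
        (trans (∑∑-distrib-+ same (λ v w → 𝟙 (leaves v w) * wrong v w + 𝟙 (leaves w v) * wrong v w))
               (cong (∑[ v < n ] ∑[ w < n ] same v w +_) ∑-cross))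
        where
        pointwise : ∀ x y t → t ≡ 𝟙 (not (x xor y)) * t + (𝟙 (x ∧ not y) * t + 𝟙 (y ∧ not x) * t)
        pointwise true  true  t = lemma t
          where lemma : ∀ t → t ≡ 1 * t + (0 * t + 0 * t)
                lemma = solve-∀
        pointwise true  false t = lemma t
          where lemma : ∀ t → t ≡ 0 * t + (1 * t + 0 * t)
                lemma = solve-∀
        pointwise false true  t = lemma t
          where lemma : ∀ t → t ≡ 0 * t + (0 * t + 1 * t)
                lemma = solve-∀
        pointwise false false t = lemma t
          where lemma : ∀ t → t ≡ 1 * t + (0 * t + 0 * t)
                lemma = solve-∀

      same-even : 2 ∣ ∑[ v < n ] ∑[ w < n ] same v w
      same-even = handshake n same
        (λ v w → pointwise (X v) (X w) (adj G v w) (p v w) (p w v) (nonadj-right v w)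
          (nonadj-right w v ∘ trans (Graph.sym G w v)) (wrong-uncut v w) (wrong-uncut w v ∘ trans (Graph.sym G w v)))
        -- The diagonal vanishes because `port v v` belongs to no edge of `G` and hence is right.
        (λ v → trans (cong (λ s → 𝟙 (not (X v xor X v)) * 𝟙 (s xor X v)) (nonadj-right v v (loopless G v)))
                     (trans (cong (λ s → 𝟙 (not (X v xor X v)) * 𝟙 s) (xor-same (X v))) (*-zeroʳ (𝟙 (not (X v xor X v))))))
        where
        pointwise : ∀ x y a s t → (a ≡ false → s ≡ x) → (a ≡ false → t ≡ y) →
          (a ≡ true → s ≢ x → s ≡ t) → (a ≡ true → t ≢ y → t ≡ s) →
          𝟙 (not (x xor y)) * 𝟙 (s xor x) ≡ 𝟙 (not (y xor x)) * 𝟙 (t xor y)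
        pointwise true  false a s t _ _ _ _ = refl
        pointwise false true  a s t _ _ _ _ = refl
        pointwise true  true  false s t h h′ _ _ rewrite h refl | h′ refl = refl
        pointwise false false false s t h h′ _ _ rewrite h refl | h′ refl = refl
        pointwise true  true  true true  true  _ _ _ _ = refl
        pointwise true  true  true false false _ _ _ _ = refl
        pointwise true  true  true true  false _ _ _ h = contradiction (h refl λ ()) λ ()
        pointwise true  true  true false true  _ _ h _ = contradiction (h refl λ ()) λ ()
        pointwise false false true true  true  _ _ _ _ = refl
        pointwise false false true false false _ _ _ _ = refl
        pointwise false false true true  false _ _ h _ = contradiction (h refl λ ()) λ ()
        pointwise false false true false true  _ _ _ h = contradiction (h refl λ ()) λ ()

      -- The term `b * count X` completes the inner nodes: `I + b = n + 2k` gives one copy of `X v`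
      -- to each of the `n` ports, up to an even number. A port's membership in `U`, its wrongness
      -- and `X v` have an even sum, and the loop ends in `U` come in pairs.
      count-even : 2 ∣ count U + (b * count X + W)
      count-even = subst (2 ∣_) (sym total) (sum-even at)
        where
        nodes : Fin n → ℕ
        nodes v = ∑[ w < n ] 𝟙 (p v w) + (∑[ j < k ] (𝟙 (l false v j) + 𝟙 (l true v j)) + ∑[ i < I ] 𝟙 (q v i))
        total : count U + (b * count X + W) ≡ ∑[ v < n ] (nodes v + (b * 𝟙 (X v) + ∑[ w < n ] wrong v w))
        total = trans (cong₂ _+_ (sum-nodes (𝟙 ∘ U))
            (trans (cong (_+ W) (*-distribˡ-sum b (𝟙 ∘ X))) (sym (∑-distrib-+ (λ v → b * 𝟙 (X v)) _))))
          (sym (∑-distrib-+ nodes _))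
        at : ∀ v → 2 ∣ nodes v + (b * 𝟙 (X v) + ∑[ w < n ] wrong v w)
        at v = subst (2 ∣_) (sym rearranged) (∣m∣n⇒∣m+n (sum-even λ w → parity (p v w) (X v))
            (∣m∣n⇒∣m+n (sum-even λ j → subst (λ t → 2 ∣ 𝟙 (l false v j) + 𝟙 t) (loops-agree v j) (2∣m+m (𝟙 (l false v j))))
                       (∣m⇒∣m*n (𝟙 (X v)) (2∣m+m k))))
          where
          open ≡-Reasoning
          parity : ∀ s x → 2 ∣ 𝟙 s + (𝟙 (s xor x) + 𝟙 x)
          parity true  true  = divides 1 refl
          parity true  false = divides 1 refl
          parity false true  = divides 1 refl
          parity false false = divides 0 refl
          A = ∑[ w < n ] 𝟙 (p v w)
          L = ∑[ j < k ] (𝟙 (l false v j) + 𝟙 (l true v j))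
          V = ∑[ w < n ] wrong v w
          x = 𝟙 (X v)
          rearranged : nodes v + (b * x + V) ≡ ∑[ w < n ] (𝟙 (p v w) + (wrong v w + x)) + (L + (k + k) * x)
          rearranged = begin
            (A + (L + ∑[ i < I ] 𝟙 (q v i))) + (b * x + V)
              ≡⟨ cong (λ s → (A + (L + s)) + (b * x + V)) (trans (sum-cong-≗ λ i → cong 𝟙 (q≡ v i)) (sum-const I x)) ⟩
            (A + (L + I * x)) + (b * x + V)            ≡⟨ regroup A L I b x V ⟩
            (A + V) + (L + (I + b) * x)                ≡⟨ cong (λ s → (A + V) + (L + s * x)) I+b≡ ⟩
            (A + V) + (L + (n + (k + k)) * x)          ≡⟨ regroup′ A V L n (k + k) x ⟩
            (A + (V + n * x)) + (L + (k + k) * x)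
              ≡⟨ cong (_+ (L + (k + k) * x)) (trans (∑-distrib-+ (𝟙 ∘ p v) _)
                   (cong (A +_) (trans (∑-distrib-+ (wrong v) _) (cong (V +_) (sum-const n x))))) ⟨
            ∑[ w < n ] (𝟙 (p v w) + (wrong v w + x)) + (L + (k + k) * x) ∎
            where
            regroup : ∀ A L I b x V → (A + (L + I * x)) + (b * x + V) ≡ (A + V) + (L + (I + b) * x)
            regroup = solve-∀
            regroup′ : ∀ A V L n m x → (A + V) + (L + (n + m) * x) ≡ (A + (V + n * x)) + (L + m * x)
            regroup′ = solve-∀

      flips-odd : ¬ 2 ∣ count U → ¬ 2 ∣ Q + b * count X
      flips-odd odd even = odd (∣m+n∣m⇒∣n (subst (2 ∣_) (+-comm (count U) _) count-even)
        (subst (2 ∣_) (trans (regroup (∑[ v < n ] ∑[ w < n ] same v w) Q (b * count X)) (cong (b * count X +_) (sym wrong-split)))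
               (∣m∣n⇒∣m+n same-even even)))
        where
        regroup : ∀ s q x → s + (q + x) ≡ x + (s + q)
        regroup = solve-∀

      -- A flipped edge has one wrong port, all of whose `I` edges to inner nodes are cut, at
      -- `2 * c′` each.
      hubs : 2 * (I * (Q * c′)) ≤ ∑[ v < n ] hub v
      hubs = begin
        2 * (I * (Q * c′))                                  ≡⟨ trans (rearrange I c′ Q) (cong (2 * (I * c′) *_) (sym ∑-cross)) ⟩
        2 * (I * c′) * (∑[ v < n ] ∑[ w < n ] (𝟙 (leaves v w) * wrong v w + 𝟙 (leaves w v) * wrong v w))
          ≡⟨ *-distribˡ-∑∑ (2 * (I * c′)) (λ v w → 𝟙 (leaves v w) * wrong v w + 𝟙 (leaves w v) * wrong v w) ⟩
        ∑[ v < n ] ∑[ w < n ] (2 * (I * c′) * (𝟙 (leaves v w) * wrong v w + 𝟙 (leaves w v) * wrong v w))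
          ≤⟨ ∑∑-mono (λ v w → pointwise v w) ⟩
        ∑[ v < n ] ∑[ w < n ] (I * (2 * ω v w * wrong v w))  ≡⟨ sum-cong-≗ ports-cut ⟨
        ∑[ v < n ] ⟦ ports v ⟧ (cut U)                       ≤⟨ sum-mono {n} (λ v → m≤m+n (⟦ ports v ⟧ (cut U)) _) ⟩
        ∑[ v < n ] hub v                                     ∎
        where
        open ≤-Reasoning
        rearrange : ∀ I c q → 2 * (I * (q * c)) ≡ 2 * (I * c) * q
        rearrange = solve-∀
        at-most-once : ∀ x y t → 𝟙 (x ∧ not y) * t + 𝟙 (y ∧ not x) * t ≤ t
        at-most-once true  true  t = z≤n
        at-most-once true  false t = ≤-reflexive (trans (+-identityʳ _) (+-identityʳ t))
        at-most-once false true  t = ≤-reflexive (+-identityʳ t)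
        at-most-once false false t = z≤n
        pointwise : ∀ v w → 2 * (I * c′) * (𝟙 (leaves v w) * wrong v w + 𝟙 (leaves w v) * wrong v w) ≤ I * (2 * ω v w * wrong v w)
        pointwise v w with adj G v w in a
        ... | true = ≤-trans (*-monoʳ-≤ (2 * (I * c′)) (at-most-once (X v) (X w) (wrong v w))) (≤-reflexive (lemma I c′ (wrong v w)))
          where
          lemma : ∀ I c t → 2 * (I * c) * t ≡ I * (2 * c * t)
          lemma = solve-∀
        ... | false = ≤-trans (*-monoʳ-≤ (2 * (I * c′)) (at-most-once (X v) (X w) (wrong v w)))
                (subst (λ t → 2 * (I * c′) * t ≤ I * (2 * Y * wrong v w)) (sym right) (≤-trans (≤-reflexive (*-zeroʳ (2 * (I * c′)))) z≤n))
          where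
          right : wrong v w ≡ 0
          right = cong 𝟙 (trans (cong (_xor X v) (nonadj-right v w a)) (xor-same (X v)))

      -- A straight edge is itself cut and is listed from both ends, at `I * c` each.
      outers : 2 * (I * (P * c)) ≤ ∑[ v < n ] outer v
      outers = begin
        2 * (I * (P * c))                                    ≡⟨ rearrange I c P ⟩
        I * c * (P + P)                                      ≡⟨ cong (λ s → I * c * (P + s)) (∑-comm straight) ⟩
        I * c * (P + ∑[ v < n ] ∑[ w < n ] straight w v)     ≡⟨ cong (I * c *_) (∑∑-distrib-+ straight (λ v w → straight w v)) ⟨
        I * c * (∑[ v < n ] ∑[ w < n ] (straight v w + straight w v))   ≡⟨ *-distribˡ-∑∑ (I * c) (λ v w → straight v w + straight w v) ⟩
        ∑[ v < n ] ∑[ w < n ] (I * c * (straight v w + straight w v))   ≤⟨ ∑∑-mono pointwise ⟩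
        ∑[ v < n ] ∑[ w < n ] edge-cost v w                  ≤⟨ edges≤outer ⟩
        ∑[ v < n ] outer v                                   ∎
        where
        open ≤-Reasoning
        rearrange : ∀ I c p → 2 * (I * (p * c)) ≡ I * c * (p + p)
        rearrange = solve-∀
        bits : ∀ d x y a s t → d * (𝟙 ((x ∧ not y) ∧ (a ∧ (s ∧ not t))) + 𝟙 ((y ∧ not x) ∧ (a ∧ (t ∧ not s))))
             ≤ (if a then d else 0) * 𝟙 (s xor t)
        bits d true  true  a s t = ≤-trans (≤-reflexive (*-zeroʳ d)) z≤n
        bits d false false a s t = ≤-trans (≤-reflexive (*-zeroʳ d)) z≤n
        bits d true  false false s t = ≤-reflexive (*-zeroʳ d)
        bits d false true  false s t = ≤-reflexive (*-zeroʳ d)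
        bits d true  false true true  true  = ≤-refl
        bits d true  false true true  false = ≤-refl
        bits d true  false true false t     = ≤-trans (≤-reflexive (*-zeroʳ d)) z≤n
        bits d false true  true true  true  = ≤-refl
        bits d false true  true false true  = ≤-refl
        bits d false true  true s     false = ≤-trans (≤-reflexive (*-zeroʳ d)) z≤n
        pointwise : ∀ v w → I * c * (straight v w + straight w v) ≤ edge-cost v w
        pointwise v w = subst (λ a → I * c * (straight v w + 𝟙 (leaves w v ∧ (a ∧ (p w v ∧ not (p v w))))) ≤ edge-cost v w)
          (Graph.sym G v w) (bits (I * c) (X v) (X w) (adj G v w) (p v w) (p w v))

      good-cut : ¬ 2 ∣ count U → Λ ≤ κ
      good-cut odd = begin
        2 * (I * Y)                                   ≤⟨ *-monoʳ-≤ 2 (*-monoʳ-≤ I (cut-condition X P Q boundary (flips-odd odd))) ⟩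
        2 * (I * (P * c + Q * c′))                    ≡⟨ rearrange I (P * c) (Q * c′) ⟩
        2 * (I * (Q * c′)) + 2 * (I * (P * c))        ≤⟨ +-mono-≤ hubs outers ⟩
        ∑[ v < n ] hub v + ∑[ v < n ] outer v         ≡⟨ κ-split ⟨
        κ                                             ∎
        where
        open ≤-Reasoning
        rearrange : ∀ I p q → 2 * (I * (p + q)) ≡ 2 * (I * q) + 2 * (I * p)
        rearrange = solve-∀

  odd-cut : ¬ 2 ∣ count U → Λ ≤ κ
  odd-cut odd with any? (λ v → any? λ i → ¬? (q v i ≟ᵇ q v i₀))
  ... | yes (v , i , q≢) = mixed-hub v i q≢
  ... | no pure = decide
    where
    q≡ : ∀ v i → q v i ≡ q v i₀
    q≡ v i = decidable-stable (q v i ≟ᵇ q v i₀) (λ q≢ → pure (v , i , q≢))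
    open Pure q≡
    decide : Λ ≤ κ
    decide with any? (λ v → any? λ w → adj G v w ≟ᵇ false ×-dec ¬? (p v w ≟ᵇ X v))
    ... | yes (v , w , a , p≢) = bad-port v w a p≢
    ... | no ports-ok with any? (λ v → any? λ j → ¬? (l false v j ≟ᵇ l true v j))
    ...   | yes (v , j , l≢) = bad-loop v j l≢
    ...   | no loops-ok with any? (λ v → any? λ w → adj G v w ≟ᵇ true ×-dec ¬? (p v w ≟ᵇ X v) ×-dec ¬? (p v w ≟ᵇ p w v))
    ...     | yes (v , w , a , p≢X , p≢p) = bad-edge v w a p≢X p≢p
    ...     | no edges-ok = Good.good-cut
                (λ v w a → decidable-stable (p v w ≟ᵇ X v) (λ p≢ → ports-ok (v , w , a , p≢)))
                (λ v j → decidable-stable (l false v j ≟ᵇ l true v j) (λ l≢ → loops-ok (v , j , l≢)))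
                (λ v w a p≢X → decidable-stable (p v w ≟ᵇ p w v) (λ p≢p → edges-ok (v , w , a , p≢X , p≢p)))
                odd

-- Regular m-edge-connected graphs

leaving-walk : ∀ {n} {A : Fin n → Fin n → Bool} (X : Fin n → Bool) {u v} → Reach A u v → T (X u) → ¬ T (X v) →
               ∃ λ x → ∃ λ y → T (A x y) × T (X x) × ¬ T (X y)
leaving-walk X here Xu ¬Xu = contradiction Xu ¬Xu
leaving-walk X {u} (step {v = w} a walk) Xu ¬Xv with T? (X w)
... | yes Xw = leaving-walk X walk Xw ¬Xv
... | no ¬Xw = u , w , a , Xu , ¬Xw

length-concatMap : ∀ {A B : Set} (f : A → List B) xs → length (concatMap f xs) ≡ List.sum (map (length ∘ f) xs)
length-concatMap f []       = refl
length-concatMap f (x ∷ xs) = trans (length-++ (f x)) (cong (length (f x) +_) (length-concatMap f xs))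

-- Once all edges leaving `X` are deleted, no walk leads from `u` to `v`.
edge-boundary : ∀ {n} (G : Graph n) {m} → EdgeConnected G m → ∀ X {u v} → T (X u) → ¬ T (X v) → m ≤ ∂ G X
edge-boundary {n} G {m} conn X {u} {v} Xu ¬Xv = ≮⇒≥ λ ∂<m →
  let (x , y , a , Xx , ¬Xy) = leaving-walk X (conn D (subst (_< m) (sym length-D) ∂<m) u v) Xu ¬Xv
      (axy , uncut) = Equivalence.to (T-∧ {adj G x y}) a
  in subst (T ∘ not) (Equivalence.to T-≡ (deleted Xx ¬Xy axy)) uncut
  where
  leaves : Fin n → Fin n → Bool
  leaves v w = X v ∧ not (X w) ∧ adj G v w
  if-edge : Fin n → Fin n → List (Fin n × Fin n)
  if-edge v w = if leaves v w then (v , w) ∷ [] else []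
  from : Fin n → List (Fin n × Fin n)
  from v = concatMap (if-edge v) (allFin n)
  D : List (Fin n × Fin n)
  D = concatMap from (allFin n)
  length-D : length D ≡ ∂ G X
  length-D = trans (length-concatMap from (allFin n)) (trans (sum-allFin (length ∘ from))
    (sum-cong-≗ λ v → trans (length-concatMap (if-edge v) (allFin n)) (trans (sum-allFin (length ∘ if-edge v))
      (sum-cong-≗ λ w → single v w))))
    where
    single : ∀ v w → length (if-edge v w) ≡ 𝟙 (leaves v w)
    single v w with leaves v w
    ... | true  = refl
    ... | false = refl
  deleted : ∀ {x y} → T (X x) → ¬ T (X y) → T (adj G x y) → T ((x , y) ∈ₑ D)
  deleted {x} {y} Xx ¬Xy axy = any⁺ _ (concatMap⁺ from (lose (∈-allFin x) (concatMap⁺ (if-edge x) (lose (∈-allFin y) at))))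
    where
    at : Any (λ e → T ((⌊ proj₁ e ≟ x ⌋ ∧ ⌊ proj₂ e ≟ y ⌋) ∨ (⌊ proj₁ e ≟ y ⌋ ∧ ⌊ proj₂ e ≟ x ⌋))) (if-edge x y)
    at with X x | X y | adj G x y
    ... | true | true  | _    = contradiction tt ¬Xy
    ... | true | false | true = here (hit (x ≟ x) (y ≟ y))
      where
      hit : (d : Dec (x ≡ x)) (e : Dec (y ≡ y)) → ∀ {c} → T ((⌊ d ⌋ ∧ ⌊ e ⌋) ∨ c)
      hit (yes _) (yes _) = tt
      hit (yes _) (no ¬e) = contradiction refl ¬e
      hit (no ¬d) _       = contradiction refl ¬d

-- The degree sum over `X` counts boundary edges once and edges within `X` twice.
boundary-parity : ∀ {n} (G : Graph n) {r} → Regular G r → ∀ X → 2 ∣ ∂ G X + r * count X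
boundary-parity {n} G {r} reg X = subst (2 ∣_) (sym total) (∣m∣n⇒∣m+n (2∣m+m (∂ G X)) within-even)
  where
  within : Fin n → Fin n → ℕ
  within v w = 𝟙 (X v ∧ X w ∧ adj G v w)
  within-even : 2 ∣ ∑[ v < n ] ∑[ w < n ] within v w
  within-even = handshake n within
    (λ v w → trans (cong (λ a → 𝟙 (X v ∧ X w ∧ a)) (Graph.sym G v w)) (swap (X v) (X w) (adj G w v)))
    (λ v → trans (cong (λ a → 𝟙 (X v ∧ X v ∧ a)) (loopless G v)) (no-loop (X v)))
    where
    swap : ∀ x y a → 𝟙 (x ∧ y ∧ a) ≡ 𝟙 (y ∧ x ∧ a)
    swap true  true  a = refl
    swap true  false a = refl
    swap false true  a = refl
    swap false false a = refl
    no-loop : ∀ x → 𝟙 (x ∧ x ∧ false) ≡ 0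
    no-loop true  = refl
    no-loop false = refl
  total : ∂ G X + r * count X ≡ (∂ G X + ∂ G X) + ∑[ v < n ] ∑[ w < n ] within v w
  total = trans (cong (∂ G X +_) (begin
    r * count X                                                ≡⟨ *-distribˡ-sum r (𝟙 ∘ X) ⟩
    ∑[ v < n ] (r * 𝟙 (X v))                                   ≡⟨ sum-cong-≗ (λ v → cong (_* 𝟙 (X v)) (trans (sym (reg v)) (sum-allFin (𝟙 ∘ adj G v)))) ⟩
    ∑[ v < n ] (count (adj G v) * 𝟙 (X v))                     ≡⟨ sum-cong-≗ (λ v → *-distribʳ-sum (𝟙 (X v)) (𝟙 ∘ adj G v)) ⟩
    ∑[ v < n ] ∑[ w < n ] (𝟙 (adj G v w) * 𝟙 (X v))            ≡⟨ ∑∑-cong (λ v w → pointwise (X v) (X w) (adj G v w)) ⟩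
    ∑[ v < n ] ∑[ w < n ] (𝟙 (X v ∧ not (X w) ∧ adj G v w) + within v w)
      ≡⟨ ∑∑-distrib-+ (λ v w → 𝟙 (X v ∧ not (X w) ∧ adj G v w)) within ⟩
    ∂ G X + ∑[ v < n ] ∑[ w < n ] within v w ∎)) (sym (+-assoc (∂ G X) (∂ G X) _))
    where
    open ≡-Reasoning
    pointwise : ∀ x y a → 𝟙 a * 𝟙 x ≡ 𝟙 (x ∧ not y ∧ a) + 𝟙 (x ∧ y ∧ a)
    pointwise true  true  true  = refl
    pointwise true  true  false = refl
    pointwise true  false true  = refl
    pointwise true  false false = refl
    pointwise false y true  = refl
    pointwise false y false = refl

-- x stands for the size of the side X of a cut: p edges are cut in the usual way, q are flipped.
Isolating : ℕ → ℕ → ℕ → ℕ → ℕ → ℕ → Set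
Isolating m r b Y c c′ = ∀ p q x → m ≤ p + q → 2 ∣ (p + q) + r * x → ¬ 2 ∣ q + b * x → Y ≤ p * c + q * c′

-- The equation `r * c + k * (z + z) ≡ b * Y` is the fractional degree condition: edges and loops at
-- a vertex weigh `b` together, a loop counting twice. It yields the balance at the inner nodes.
fractional⇒factor : ∀ {n} (G : Graph n) {r m} → Regular G r → EdgeConnected G m → ∀ a b k Y c c′ z z′ →
  a + (k + k) ≡ b → b < r → 2 ∣ b * n → 1 ≤ Y → c + c′ ≡ Y → z + z′ ≡ Y → r * c + k * (z + z) ≡ b * Y →
  Isolating m r b Y c c′ → ParityFactor G a b
-- The inequality `r ≤ n` below is read off at a vertex, so the empty graph is treated apart.
fractional⇒factor {zero} G reg conn a b k Y c c′ z z′ _ _ _ _ _ _ _ _ = record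
  { F = λ () ; F-sym = λ () ; F-sub = λ () ; lower = λ () ; upper = λ () ; parity = λ () }
fractional⇒factor {n@(suc n-1)} G {r} {m} reg conn a b k Y c c′ z z′ a+2k≡b b<r 2∣bn 1≤Y c+c′≡Y z+z′≡Y saturated isolating =
  Factor.parity-factor μ μ-inv μ-adj a+2k≡b I+b≡
  where
  -- This is `n − b + 2k`; since `b < r ≤ n` it can be written as a successor, which supplies the
  -- inner node `zero`.
  I : ℕ
  I = suc (n ∸ suc b) + (k + k)
  r≤n : r ≤ n
  r≤n = subst₂ _≤_ (trans (sym (sum-allFin (𝟙 ∘ adj G zero))) (reg zero)) (trans (sum-const n 1) (*-identityʳ n))
              (sum-mono λ w → 𝟙≤1 (adj G zero w))
  I+b≡ : I + b ≡ n + (k + k)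
  I+b≡ = trans (regroup (n ∸ suc b) (k + k) b) (cong (_+ (k + k)) (m∸n+n≡m (≤-trans b<r r≤n)))
    where
    regroup : ∀ x y b → suc x + y + b ≡ (x + suc b) + y
    regroup = solve-∀
  balance : ∀ v → ∑[ w < n ] (if adj G v w then c′ else Y) + k * (z′ + z′) ≡ I * Y
  balance v = +-cancelʳ-≡ (b * Y) _ _ (begin
    (Ω + k * (z′ + z′)) + b * Y                            ≡⟨ cong ((Ω + k * (z′ + z′)) +_) saturated ⟨
    (Ω + k * (z′ + z′)) + (r * c + k * (z + z))            ≡⟨ regroup Ω k z z′ (r * c) ⟩
    (Ω + r * c) + k * ((z + z′) + (z + z′))                ≡⟨ cong₂ (λ s y → s + k * (y + y)) Ω+rc z+z′≡Y ⟩
    n * Y + k * (Y + Y)                                    ≡⟨ regroup′ n k Y ⟩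
    (n + (k + k)) * Y                                      ≡⟨ cong (_* Y) I+b≡ ⟨
    (I + b) * Y                                            ≡⟨ *-distribʳ-+ Y I b ⟩
    I * Y + b * Y                                          ∎)
    where
    open ≡-Reasoning
    Ω = ∑[ w < n ] (if adj G v w then c′ else Y)
    regroup : ∀ Ω k z z′ x → (Ω + k * (z′ + z′)) + (x + k * (z + z)) ≡ (Ω + x) + k * ((z + z′) + (z + z′))
    regroup = solve-∀
    regroup′ : ∀ n k Y → n * Y + k * (Y + Y) ≡ (n + (k + k)) * Y
    regroup′ = solve-∀
    pointwise : ∀ a → (if a then c′ else Y) + 𝟙 a * c ≡ Y
    pointwise true  = trans (+-comm c′ (c + 0)) (trans (cong (_+ c′) (+-identityʳ c)) c+c′≡Y)
    pointwise false = +-identityʳ Y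
    Ω+rc : Ω + r * c ≡ n * Y
    Ω+rc = trans (cong (λ d → Ω + d * c) (trans (sym (reg v)) (sum-allFin (𝟙 ∘ adj G v))))
      (trans (cong (Ω +_) (*-distribʳ-sum c (𝟙 ∘ adj G v)))
        (trans (sym (∑-distrib-+ (λ w → if adj G v w then c′ else Y) (λ w → 𝟙 (adj G v w) * c)))
          (trans (sum-cong-≗ λ w → pointwise (adj G v w)) (sum-const n Y))))
  cut-condition : ∀ X p q → p + q ≡ ∂ G X → ¬ 2 ∣ q + b * count X → Y ≤ p * c + q * c′
  cut-condition X p q p+q≡∂ odd with any? (λ v → T? (X v)) | any? (λ v → ¬? (T? (X v)))
  ... | yes (u , Xu) | yes (v , ¬Xv) =
    isolating p q (count X) (subst (m ≤_) (sym p+q≡∂) (edge-boundary G conn X Xu ¬Xv))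
      (subst (λ e → 2 ∣ e + r * count X) (sym p+q≡∂) (boundary-parity G reg X)) odd
  -- Edge-connectivity says nothing about an empty or full `X`. Such a set has no boundary, and
  -- `b * count X` is 0 or `b * n`, both even.
  ... | no none | _ = contradiction (subst (2 ∣_) (sym (cong₂ (λ s t → s + b * t) q≡0 count≡0))
                        (subst (2 ∣_) (sym (*-zeroʳ b)) (2 ∣0))) odd
    where
    X≡false : ∀ v → X v ≡ false
    X≡false v with X v in eq
    ... | false = refl
    ... | true  = contradiction (v , subst T (sym eq) tt) none
    count≡0 : count X ≡ 0
    count≡0 = sum-zero (cong 𝟙 ∘ X≡false)
    q≡0 : q ≡ 0
    q≡0 = m+n≡0⇒n≡0 p (trans p+q≡∂ (sum-zero λ v → sum-zero {n} λ w → cong (λ x → 𝟙 (x ∧ not (X w) ∧ adj G v w)) (X≡false v)))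
  ... | yes _ | no all = contradiction (subst (2 ∣_) (sym (cong₂ (λ s t → s + b * t) q≡0 count≡n)) 2∣bn) odd
    where
    X≡true : ∀ v → X v ≡ true
    X≡true v with X v in eq
    ... | true  = refl
    ... | false = contradiction (v , λ Xv → subst T eq Xv) all
    count≡n : count X ≡ n
    count≡n = trans (sum-cong-≗ (cong 𝟙 ∘ X≡true)) (trans (sum-const n 1) (*-identityʳ n))
    q≡0 : q ≡ 0
    q≡0 = m+n≡0⇒n≡0 p (trans p+q≡∂ (sum-zero λ v → sum-zero {n} λ w →
      cong₂ (λ x y → 𝟙 (x ∧ not y ∧ adj G v w)) (X≡true v) (X≡true w)))
  open Gadget G k I
  open Weighting G k I Y c c′ z z′ c+c′≡Y z+z′≡Y balance
  open Matchings E (λ {x} {y} → E-sym {x} {y}) E? using (Matching; module Matching)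
  perfect : ∃ λ M → Matching (λ _ → ⊥) M × ∀ x → M x ≢ x
  perfect = weighted-tutte E (λ {x} {y} → E-sym {x} {y}) E? weights Λ
    (≤-trans 1≤Y (≤-trans (m≤m+n Y _) (m≤n*m (I * Y) 2))) supported (λ g → ≤-reflexive (load g))
    (λ U → OddCut.odd-cut G k I Y c c′ z z′ b c+c′≡Y z+z′≡Y balance I+b≡ zero cut-condition U)
  M = proj₁ perfect
  M-matching = proj₁ (proj₂ perfect)
  μ : Node → Node
  μ = decode ∘ M ∘ encode
  μ-inv : ∀ x → μ (μ x) ≡ x
  μ-inv x = trans (cong (decode ∘ M) (encode-decode (M (encode x))))
    (trans (cong decode (Matching.involutive M-matching (encode x))) (decode-encode x))
  μ-adj : ∀ x → Adj x (μ x)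
  μ-adj x = subst (λ y → Adj y (μ x)) (decode-encode x)
    (Matching.edge M-matching (encode x) (proj₂ (proj₂ perfect) (encode x)))

-- Choice of the weights in the three parity cases

odd⇒¬2∣ : ∀ {m} → m % 2 ≡ 1 → ¬ 2 ∣ m
odd⇒¬2∣ {m} odd 2∣m = case trans (sym odd) (n∣m⇒m%n≡0 m 2 2∣m) of λ ()

both-positive : ∀ {p q c c′ Y} → c + c′ ≡ Y → 1 ≤ p → 1 ≤ q → Y ≤ p * c + q * c′
both-positive {p} {q} {c} {c′} c+c′≡Y 1≤p 1≤q = subst (_≤ p * c + q * c′) c+c′≡Y
  (+-mono-≤ (m≤n*m c p {{>-nonZero 1≤p}}) (m≤n*m c′ q {{>-nonZero 1≤q}}))

half-difference : ∀ {a b} → a ≤ b → a % 2 ≡ b % 2 → ∃ λ k → a + (k + k) ≡ b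
half-difference {a} {b} a≤b a≡b = b / 2 ∸ a / 2 , (begin
  a + ((b / 2 ∸ a / 2) + (b / 2 ∸ a / 2))                        ≡⟨ cong (_+ ((b / 2 ∸ a / 2) + (b / 2 ∸ a / 2))) (m≡m%n+[m/n]*n a 2) ⟩
  (a % 2 + a / 2 * 2) + ((b / 2 ∸ a / 2) + (b / 2 ∸ a / 2))      ≡⟨ regroup (a % 2) (a / 2) (b / 2 ∸ a / 2) ⟩
  a % 2 + ((b / 2 ∸ a / 2) + a / 2) * 2                          ≡⟨ cong₂ (λ ρ h → ρ + h * 2) a≡b (m∸n+n≡m (/-monoˡ-≤ 2 a≤b)) ⟩
  b % 2 + b / 2 * 2                                              ≡⟨ m≡m%n+[m/n]*n b 2 ⟨
  b                                                              ∎)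
  where
  open ≡-Reasoning
  regroup : ∀ ρ h d → (ρ + h * 2) + (d + d) ≡ ρ + (d + h) * 2
  regroup = solve-∀

-- `mstar` is the least odd number not below `m`.
odd-above : ∀ {m mstar e} → (mstar ≡ m ⊎ mstar ≡ suc m) → mstar % 2 ≡ 1 → m ≤ e → ¬ 2 ∣ e → mstar ≤ e
odd-above (inj₁ refl) _ m≤e _ = m≤e
odd-above {m} {e = e} (inj₂ refl) odd m≤e ¬2∣e with m ≟ℕ e
... | no m≢e = ≤∧≢⇒< m≤e m≢e
... | yes refl = case ∣1⇒≡1 (∣m+n∣m⇒∣n (subst (2 ∣_) (+-comm 1 (m + m)) (odd+odd (odd⇒¬2∣ odd) ¬2∣e)) (2∣m+m m))
                 of λ ()

-- Since `b` is even, `q` is odd and in particular positive. Only `p = 0` is critical, and then `q`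
-- is an odd number of edges, at least `mstar`.
isolating-even : ∀ {m mstar r b c c′} → (mstar ≡ m ⊎ mstar ≡ suc m) → mstar % 2 ≡ 1 → c + c′ ≡ r → 2 ∣ b →
                 r ≤ mstar * c′ → Isolating m r b r c c′
isolating-even {b = b} {c} {c′} m∼ m-odd c+c′≡r 2∣b r≤ p q x m≤p+q _ odd = go p m≤p+q
  where
  ¬2∣q : ¬ 2 ∣ q
  ¬2∣q 2∣q = odd (∣m∣n⇒∣m+n 2∣q (∣m⇒∣m*n x 2∣b))
  1≤q : 1 ≤ q
  1≤q = n≢0⇒n>0 λ { refl → ¬2∣q (2 ∣0) }
  go : ∀ p → _ ≤ p + q → _ ≤ p * _ + q * c′
  go zero    m≤q = ≤-trans r≤ (*-monoˡ-≤ c′ (odd-above m∼ m-odd m≤q ¬2∣q))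
  go (suc p) _   = both-positive {suc p} {q} {c} c+c′≡r (s≤s z≤n) 1≤q

-- Adding the two parity conditions eliminates `x`, because `r + b` is even, and leaves `p` odd. Now
-- `q = 0` is the critical case.
isolating-odd : ∀ {m mstar r b c c′} → (mstar ≡ m ⊎ mstar ≡ suc m) → mstar % 2 ≡ 1 → c + c′ ≡ r → 2 ∣ r + b →
                r ≤ mstar * c → Isolating m r b r c c′
isolating-odd {m} {r = r} {b} {c} {c′} m∼ m-odd c+c′≡r 2∣r+b r≤ p q x m≤p+q even odd = go q refl
  where
  ¬2∣p : ¬ 2 ∣ p
  ¬2∣p 2∣p = odd (∣m+n∣m⇒∣n (subst (2 ∣_) (regroup q r b x) (∣m∣n⇒∣m+n (2∣m+m q) (∣m⇒∣m*n x 2∣r+b)))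
                            (∣m+n∣m⇒∣n (subst (2 ∣_) (+-assoc p q (r * x)) even) 2∣p))
    where
    regroup : ∀ q r b x → q + q + (r + b) * x ≡ (q + r * x) + (q + b * x)
    regroup = solve-∀
  1≤p : 1 ≤ p
  1≤p = n≢0⇒n>0 λ { refl → ¬2∣p (2 ∣0) }
  go : ∀ j → q ≡ j → r ≤ p * c + q * c′
  go zero    refl = ≤-trans (≤-trans r≤ (*-monoˡ-≤ c (odd-above m∼ m-odd (subst (m ≤_) (+-identityʳ p) m≤p+q) ¬2∣p)))
                            (m≤m+n _ _)
  go (suc j) refl = both-positive {p} {suc j} {c} c+c′≡r 1≤p (s≤s z≤n)

-- A cut that is not mixed has at least `m` edges of a single kind, and `m` of either kind already
-- weigh `Y`.
isolating-any : ∀ {m r b Y c c′} → c + c′ ≡ Y → Y ≤ m * c → Y ≤ m * c′ → Isolating m r b Y c c′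
isolating-any {c = c} {c′} c+c′≡Y Y≤mc Y≤mc′ zero    q       _ m≤q   _ _ = ≤-trans Y≤mc′ (*-monoˡ-≤ c′ m≤q)
isolating-any {c = c} {c′} c+c′≡Y Y≤mc Y≤mc′ (suc p) zero    _ m≤p+0 _ _ =
  ≤-trans Y≤mc (≤-trans (*-monoˡ-≤ c (≤-trans m≤p+0 (≤-reflexive (+-identityʳ (suc p))))) (m≤m+n _ 0))
isolating-any {c = c} c+c′≡Y Y≤mc Y≤mc′ (suc p) (suc q) _ _ _ _ = both-positive {suc p} {suc q} {c} c+c′≡Y (s≤s z≤n) (s≤s z≤n)

-- The condition `a ≤ r (1 − 1/m)`, cleared of denominators, turned into a bound on the weight
-- `r ∸ a` of a flipped edge.
complement-bound : ∀ {a r m} → a ≤ r → a * m + r ≤ r * m → r ≤ m * (r ∸ a)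
complement-bound {a} {r} {m} a≤r am+r≤rm = +-cancelˡ-≤ (a * m) _ _ (begin
  a * m + r                 ≤⟨ am+r≤rm ⟩
  r * m                     ≡⟨ cong (_* m) (m+[n∸m]≡n a≤r) ⟨
  (a + (r ∸ a)) * m         ≡⟨ distribute a (r ∸ a) m ⟩
  a * m + m * (r ∸ a)       ∎)
  where
  open ≤-Reasoning
  distribute : ∀ a d m → (a + d) * m ≡ a * m + m * d
  distribute = solve-∀

theorem2p1 : (a b r m mstar n : ℕ) → (G : Graph n) →
    1 ≤ a → a ≤ b → b < r → a % 2 ≡ b % 2 →
    1 ≤ m → (mstar ≡ m ⊎ mstar ≡ suc m) → mstar % 2 ≡ 1 →
    EdgeConnected G m → Regular G r →
    ((r % 2 ≡ 0 × a % 2 ≡ 1 × b % 2 ≡ 1 × n % 2 ≡ 0 × r ≤ b * m × a * m + r ≤ r * m)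
    ⊎ (r % 2 ≡ 1 × a % 2 ≡ 0 × b % 2 ≡ 0 × a * mstar + r ≤ r * mstar)
    ⊎ (r % 2 ≡ 1 × a % 2 ≡ 1 × b % 2 ≡ 1 × r ≤ b * mstar)) →
    ParityFactor G a b
theorem2p1 a b r m mstar n G 1≤a a≤b b<r a≡b 1≤m m∼ m-odd conn reg conditions
  with half-difference a≤b a≡b
... | k , refl = cases conditions
  where
  a≤r : a ≤ r
  a≤r = ≤-trans a≤b (<⇒≤ b<r)
  1≤r : 1 ≤ r
  1≤r = ≤-trans 1≤a a≤r
  D : ℕ
  D = k + k
  -- The two ends of the admissible range with `Y = r`: edge weight `a/r` with all loops at weight
  -- 1, and `b/r` with all loops at weight 0.
  at-lower : ∀ r a k → r * a + k * (r + r) ≡ (a + (k + k)) * r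
  at-lower = solve-∀
  at-upper : ∀ r b k → r * b + k * (0 + 0) ≡ b * r
  at-upper = solve-∀
  cases : _ → ParityFactor G a (a + D)
  -- If a/r falls below the bound 1/m required in case (i), the edge weight 1/m itself is admissible.
  cases (inj₁ (_ , _ , _ , n-even , r≤bm , am+r≤rm)) with r ≤? a * m
  ... | yes r≤am = fractional⇒factor G reg conn a b k r a (r ∸ a) r 0 refl b<r 2∣bn 1≤r
          (m+[n∸m]≡n a≤r) (+-identityʳ r) (at-lower r a k)
          (isolating-any {m} {r} {b} (m+[n∸m]≡n a≤r) (subst (r ≤_) (*-comm a m) r≤am) (complement-bound {a} {r} {m} a≤r am+r≤rm))
    where
    2∣bn : 2 ∣ b * n
    2∣bn = ∣n⇒∣m*n b (m%n≡0⇒n∣m n 2 n-even)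
  -- Edge weight `1/m` forces loop weight `(b − r/m)/(b − a)`; the denominator `Y = m * D` with
  -- `D = b − a` makes both integral.
  ... | no r≰am = fractional⇒factor G reg conn a b k (m * D) D ((m ∸ 1) * D) (b * m ∸ r) (r ∸ a * m) refl b<r
          (∣n⇒∣m*n b (m%n≡0⇒n∣m n 2 n-even)) (≤-trans 1≤D (m≤n*m D m {{>-nonZero 1≤m}})) D+
          slack saturated (isolating-any {m} {r} {b} D+ ≤-refl (*-monoʳ-≤ m (m≤n*m D (m ∸ 1) {{>-nonZero 1≤m-1}})))
    where
    am<r : a * m < r
    am<r = ≰⇒> r≰am
    1≤D : 1 ≤ D
    1≤D = n≢0⇒n>0 λ D≡0 → <⇒≱ am<r
      (subst (λ x → r ≤ x * m) (trans (cong (a +_) D≡0) (+-identityʳ a)) r≤bm)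
    -- For `m = 1` the hypothesis would read `a + r ≤ r`.
    1≤m-1 : 1 ≤ m ∸ 1
    1≤m-1 = n≢0⇒n>0 λ m-1≡0 → <⇒≱ (m<n+m r {a} 1≤a)
      (subst₂ _≤_ (cong (_+ r) (*-identityʳ a)) (*-identityʳ r)
        (subst (λ m → a * m + r ≤ r * m) (≤-antisym (m∸n≡0⇒m≤n m-1≡0) 1≤m) am+r≤rm))
    D+ : D + (m ∸ 1) * D ≡ m * D
    D+ = cong (_* D) (m+[n∸m]≡n 1≤m)
    slack : (b * m ∸ r) + (r ∸ a * m) ≡ m * D
    slack = +-cancelʳ-≡ (a * m) _ _ (begin
      (b * m ∸ r) + (r ∸ a * m) + a * m      ≡⟨ +-assoc (b * m ∸ r) _ _ ⟩
      (b * m ∸ r) + ((r ∸ a * m) + a * m)    ≡⟨ cong ((b * m ∸ r) +_) (m∸n+n≡m (<⇒≤ am<r)) ⟩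
      (b * m ∸ r) + r                        ≡⟨ m∸n+n≡m r≤bm ⟩
      (a + D) * m                            ≡⟨ distribute a D m ⟩
      m * D + a * m                          ∎)
      where
      open ≡-Reasoning
      distribute : ∀ a d m → (a + d) * m ≡ m * d + a * m
      distribute = solve-∀
    saturated : r * D + k * ((b * m ∸ r) + (b * m ∸ r)) ≡ b * (m * D)
    saturated = begin
      r * D + k * ((b * m ∸ r) + (b * m ∸ r))     ≡⟨ factor r k (b * m ∸ r) ⟩
      ((b * m ∸ r) + r) * D                       ≡⟨ cong (_* D) (m∸n+n≡m r≤bm) ⟩
      b * m * D                                   ≡⟨ *-assoc b m D ⟩
      b * (m * D)                                 ∎
      where
      open ≡-Reasoning
      factor : ∀ r k z → r * (k + k) + k * (z + z) ≡ (z + r) * (k + k)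
      factor = solve-∀
  cases (inj₂ (inj₁ (_ , _ , b-even , am+r≤rm))) = fractional⇒factor G reg conn a b k r a (r ∸ a) r 0 refl b<r
    (∣m⇒∣m*n n 2∣b) 1≤r (m+[n∸m]≡n a≤r) (+-identityʳ r) (at-lower r a k)
    (isolating-even {r = r} {b} m∼ m-odd (m+[n∸m]≡n a≤r) 2∣b (complement-bound {a} {r} {mstar} a≤r am+r≤rm))
    where 2∣b = m%n≡0⇒n∣m b 2 b-even
  cases (inj₂ (inj₂ (r-odd , _ , b-odd , r≤bm*))) = fractional⇒factor G reg conn a b k r b (r ∸ b) 0 r refl b<r
    2∣bn 1≤r (m+[n∸m]≡n (<⇒≤ b<r)) refl (at-upper r b k)
    (isolating-odd {r = r} {b} m∼ m-odd (m+[n∸m]≡n (<⇒≤ b<r)) 2∣r+b (subst (r ≤_) (*-comm b mstar) r≤bm*))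
    where
    2∣r+b : 2 ∣ r + b
    2∣r+b = odd+odd {r} {b} (odd⇒¬2∣ {r} r-odd) (odd⇒¬2∣ {b} b-odd)
    -- The full vertex set has empty boundary, so its parity condition is that `r * n` is even; this
    -- passes to `b * n` because `r + b` is even.
    2∣rn : 2 ∣ r * n
    2∣rn = subst (2 ∣_) (cong₂ (λ s t → s + r * t) (sum-zero {n} λ v → sum-zero {n} λ w → refl)
                          (trans (sum-const n 1) (*-identityʳ n))) (boundary-parity G reg (λ _ → true))
    2∣bn : 2 ∣ b * n
    2∣bn = ∣m+n∣m⇒∣n (subst (2 ∣_) (*-distribʳ-+ n r b) (∣m⇒∣m*n n 2∣r+b)) 2∣rn
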